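{- For every odd prime $p>2$, \[ \sum_{n=0}^{p-1}\frac{(\frac{1}{2})_n(\frac{1}{3})_n(\frac{2}{3})_n}{(1)_n^3}\left(11n+3\right)\left(\frac{27}{16}\right)^n\equiv 3p \pmod{p^3}. \] Equivalently, $\sum_{n=0}^{p-1}\frac{11n+3}{64^n}\binom{2n}{n}^2\binom{3n}{n}\equiv 3p \pmod{p^3}$.
   Context: $(a)_n=\prod_{k=0}^{n-1}(a+k)$ denotes the Pochhammer symbol (rising factorial), with $(a)_0=1$. Congruences between rational numbers whose denominators are coprime to $p$ are understood in the ring of $p$-integral rationals. -}

module Defs where

open import Algebra.Definitions.RawSemiring as RawSemiringDefs using ()
open import Data.Fin.Base as Fin using (toℕ)
open import Data.Integer.Base as ℤ using (+_)
open import Data.Nat.Base as ℕ using (ℕ; zero; suc)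
open import Data.Nat.Combinatorics using (_C_)
open import Data.Nat.Coprimality using (Coprime)
open import Data.Nat.Properties as ℕₚ using ()
open import Data.Product.Base using (_×_; ∃-syntax)
open import Data.Rational.Base
open import Data.Rational.Properties
open import Data.Vec.Functional using (Vector)
open import Relation.Binary.PropositionalEquality.Core using (_≡_)

open RawSemiringDefs +-*-rawSemiring using (product; _^_)

fromℕ : ℕ → ℚ
fromℕ n = + n / 1

pochhammer : ℚ → ℕ → ℚ
pochhammer a n = product {n} (λ k → a + fromℕ (toℕ k))

-- A rational is p-integral when its denominator in lowest terms is coprime
-- to p; elements of ℚ are always stored in lowest terms.
Integralₚ : ℕ → ℚ → Set
Integralₚ p x = Coprime (↧ₙ x) p

-- Congruence modulo the ideal generated by p ^ k in the ring of p-integral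
-- rationals.
infix 4 _≡_[mod_^_]
_≡_[mod_^_] : ℚ → ℚ → ℕ → ℕ → Set
x ≡ y [mod p ^ k ] =
  Integralₚ p x × Integralₚ p y ×
  ∃[ z ] (Integralₚ p z × x - y ≡ fromℕ (p ℕ.^ k) * z)

product-pos : ∀ {n} (v : Vector ℚ n) → (∀ i → Positive (v i)) → Positive (product v)
product-pos {zero}  v v>0 = _
product-pos {suc n} v v>0 =
  pos*pos⇒pos (v Fin.zero) {{v>0 Fin.zero}}
    (product tail) {{product-pos tail (λ i → v>0 (Fin.suc i))}}
  where
  tail : Vector ℚ n
  tail i = v (Fin.suc i)

pochhammer-1-pos : ∀ n → Positive (pochhammer 1ℚ n)
pochhammer-1-pos n = product-pos {n} (λ k → 1ℚ + fromℕ (toℕ k)) λ k →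
  pos+nonNeg⇒pos 1ℚ (fromℕ (toℕ k)) {{normalize-nonNeg (toℕ k) 1}}

pochhammer-1-cubed-nonZero : ∀ n → NonZero (pochhammer 1ℚ n ^ 3)
pochhammer-1-cubed-nonZero n = pos⇒nonZero (pochhammer 1ℚ n ^ 3)
  {{product-pos {3} (λ _ → pochhammer 1ℚ n) (λ _ → pochhammer-1-pos n)}}

pochhammerTerm : ℕ → ℚ
pochhammerTerm n =
  ((pochhammer (+ 1 / 2) n * pochhammer (+ 1 / 3) n * pochhammer (+ 2 / 3) n)
    ÷ (pochhammer 1ℚ n ^ 3)) {{pochhammer-1-cubed-nonZero n}}
  * fromℕ (11 ℕ.* n ℕ.+ 3)
  * (+ 27 / 16) ^ n

binomialTerm : ℕ → ℚ
binomialTerm n =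
  (+ (11 ℕ.* n ℕ.+ 3) / (64 ℕ.^ n)) {{ℕₚ.m^n≢0 64 n}}
  * fromℕ (((2 ℕ.* n) C n) ℕ.^ 2)
  * fromℕ ((3 ℕ.* n) C n)

{-# OPTIONS --safe #-}

-- The summands t(n) of the theorem and the well-poised terms
--   φ(M,m) = 6 (4m+1) ((1/2)_m / m!)² (M+m)! (1/2)_{M-m} / M!²
-- are the two members of a WZ pair, whence the exact identity
--   Σ_{n<N} t(n) = Σ_{m<N} φ(2N-1,m).
-- Let N = p = 2n+1.  The terms with m > n are divisible by p³.  For m ≤ n, replacing
-- one factor (1/2)_m / m! by (-n)_m / (n+3/2)_m changes φ(M,m) by a multiple of p³:
-- the two factors agree modulo p, and even modulo p² when m = n, while the missing
-- powers of p are supplied by (M+m)! (1/2)_{M-m} / M!².  After the replacement the sum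
-- is a terminating case of Dougall's well-poised ₄F₃(-1) summation, which is itself
-- proved by a WZ pair, and its value is 3p times a quotient of products over the
-- pairs {j , p-j} whose factors agree modulo p².

module Submission where

-- The summands t(n) show no powers of p (already t(0) = 3), so their sum cannot be estimated term
-- by term. In φ(M,m) with M = 2p-1 the powers are visible: M+1 = 2p, M! contains p exactly once,
-- and (1/2)_k acquires the factors p/2 and 3p/2 as k grows. As a series in m, φ(M,m) is well-poised
-- with a = b = 1/2 and c = M+1, but it does not terminate. Moving b from 1/2 to 1/2 - p/2 = -n
-- moves 1+a-b from 1 to 1 + p/2 = n+3/2. The series therefore stays in Dougall's family and now
-- stops at m = n. A shift by p/2 costs one power of p, which is enough wherever the remaining
-- factors supply two. At m = n the factor 3p/2 has just left (1/2)_{M-m}, and only reading the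
-- products backwards gains the second power. At m = 0 the factor p of (M+m)!/M! is absent, but
-- there the exchanged factors are both 1.

module Supercongruence where

  open import Defs renaming (fromℕ to ι)
  open import Algebra.Bundles using (Monoid)
  import Algebra.Properties.Monoid.Sum as MonoidSum
  open import Data.Fin.Base using (toℕ)
  open import Data.Fin.Properties using (toℕ-inject₁; toℕ-fromℕ)
  open import Data.Integer.Base as ℤ using (ℤ) renaming (+_ to posℤ)
  import Data.Integer.Properties as ℤₚ
  open import Data.Nat.Base as ℕ using (ℕ; zero; suc; _∸_; z≤n; s≤s; _!) renaming (_≤_ to _≤ₙ_; _<_ to _<ₙ_)
  open import Data.Nat.Combinatorics using (_C_; nCk≡n!/k![n-k]!; k![n∸k]!∣n!)
  open import Data.Nat.Coprimality as Coprimality using (coprime-divisor)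
  open import Data.Nat.Divisibility using (_∣_; _∤_; divides; ∣-trans; >⇒∤; ∣m+n∣m⇒∣n; ∣-refl; ∣1⇒≡1)
  open import Data.Nat.DivMod using (m/n*n≡m)
  open import Data.Nat.Primality using (Prime; euclidsLemma; prime⇒irreducible; prime⇒nonTrivial)
  import Data.Nat.Properties as ℕₚ
  open import Data.Nat.Tactic.RingSolver using () renaming (solve-∀ to ℕ-solve-∀)
  open import Data.Product.Base using (_,_; ∃-syntax)
  open import Data.Rational.Base
  open import Data.Rational.Properties
  import Data.Rational.Unnormalised.Base as ℚᵘ
  import Data.Rational.Unnormalised.Properties as ℚᵘₚ
  open import Data.Sum.Base using (_⊎_; inj₁; inj₂; [_,_]′)
  open import Algebra.Definitions.RawSemiring +-*-rawSemiring using (_^_)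
  open import Level using (0ℓ)
  open import Relation.Binary.PropositionalEquality
  open import Relation.Nullary using (contradiction)
  open import Relation.Nullary.Decidable using (dec⇒maybe)
  open import Tactic.RingSolver using (solve-∀)
  open import Tactic.RingSolver.Core.AlmostCommutativeRing using (AlmostCommutativeRing; fromCommutativeRing)

  -- Integers and their reciprocals inside the rationals.

  ℚ-ring : AlmostCommutativeRing 0ℓ 0ℓ
  ℚ-ring = fromCommutativeRing +-*-commutativeRing (λ x → dec⇒maybe (0ℚ ≟ x))

  ιℤ : ℤ → ℚ
  ιℤ i = i / 1

  ιℤ-+ : ∀ i j → ιℤ (i ℤ.+ j) ≡ ιℤ i + ιℤ j
  ιℤ-+ i j = toℚᵘ-injective (begin-equality
    toℚᵘ (ιℤ (i ℤ.+ j))             ≃⟨ toℚᵘ-fromℚᵘ (ℚᵘ.mkℚᵘ (i ℤ.+ j) 0) ⟩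
    ℚᵘ.mkℚᵘ (i ℤ.+ j) 0             ≃⟨ ℚᵘ.*≡* (cong (ℤ._* posℤ 1) (cong₂ ℤ._+_ (sym (ℤₚ.*-identityʳ i)) (sym (ℤₚ.*-identityʳ j)))) ⟩
    ℚᵘ.mkℚᵘ i 0 ℚᵘ.+ ℚᵘ.mkℚᵘ j 0    ≃⟨ ℚᵘₚ.+-cong (toℚᵘ-fromℚᵘ (ℚᵘ.mkℚᵘ i 0)) (toℚᵘ-fromℚᵘ (ℚᵘ.mkℚᵘ j 0)) ⟨
    toℚᵘ (ιℤ i) ℚᵘ.+ toℚᵘ (ιℤ j)    ≃⟨ toℚᵘ-homo-+ (ιℤ i) (ιℤ j) ⟨
    toℚᵘ (ιℤ i + ιℤ j)              ∎)
    where open ℚᵘₚ.≤-Reasoning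

  ιℤ-* : ∀ i j → ιℤ (i ℤ.* j) ≡ ιℤ i * ιℤ j
  ιℤ-* i j = toℚᵘ-injective (begin-equality
    toℚᵘ (ιℤ (i ℤ.* j))             ≃⟨ toℚᵘ-fromℚᵘ (ℚᵘ.mkℚᵘ (i ℤ.* j) 0) ⟩
    ℚᵘ.mkℚᵘ (i ℤ.* j) 0             ≃⟨ ℚᵘ.*≡* refl ⟩
    ℚᵘ.mkℚᵘ i 0 ℚᵘ.* ℚᵘ.mkℚᵘ j 0    ≃⟨ ℚᵘₚ.*-cong (toℚᵘ-fromℚᵘ (ℚᵘ.mkℚᵘ i 0)) (toℚᵘ-fromℚᵘ (ℚᵘ.mkℚᵘ j 0)) ⟨
    toℚᵘ (ιℤ i) ℚᵘ.* toℚᵘ (ιℤ j)    ≃⟨ toℚᵘ-homo-* (ιℤ i) (ιℤ j) ⟨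
    toℚᵘ (ιℤ i * ιℤ j)              ∎)
    where open ℚᵘₚ.≤-Reasoning

  ι-+ : ∀ m n → ι (m ℕ.+ n) ≡ ι m + ι n
  ι-+ m n = ιℤ-+ (posℤ m) (posℤ n)

  ι-* : ∀ m n → ι (m ℕ.* n) ≡ ι m * ι n
  ι-* m n = trans (cong ιℤ (ℤₚ.pos-* m n)) (ιℤ-* (posℤ m) (posℤ n))

  ι-suc : ∀ n → ι (suc n) ≡ ι n + 1ℚ
  ι-suc n = trans (ι-+ 1 n) (+-comm 1ℚ (ι n))

  /-ι : ∀ i n .{{_ : ℕ.NonZero n}} → (i / n) * ι n ≡ ιℤ i
  /-ι i (suc n) = toℚᵘ-injective (begin-equality
    toℚᵘ ((i / suc n) * ι (suc n))                 ≃⟨ toℚᵘ-homo-* (i / suc n) (ι (suc n)) ⟩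
    toℚᵘ (i / suc n) ℚᵘ.* toℚᵘ (ι (suc n))         ≃⟨ ℚᵘₚ.*-cong (toℚᵘ-fromℚᵘ (ℚᵘ.mkℚᵘ i n)) (toℚᵘ-fromℚᵘ (ℚᵘ.mkℚᵘ (posℤ (suc n)) 0)) ⟩
    ℚᵘ.mkℚᵘ i n ℚᵘ.* ℚᵘ.mkℚᵘ (posℤ (suc n)) 0           ≃⟨ ℚᵘ.*≡* (trans (ℤₚ.*-identityʳ _) (cong (λ d → i ℤ.* posℤ d) (sym (ℕₚ.*-identityʳ (suc n))))) ⟩
    ℚᵘ.mkℚᵘ i 0                                    ≃⟨ toℚᵘ-fromℚᵘ (ℚᵘ.mkℚᵘ i 0) ⟨
    toℚᵘ (ιℤ i)                                    ∎)
    where open ℚᵘₚ.≤-Reasoning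

  recip : ℕ → ℚ
  recip n = posℤ 1 / suc n

  recip-inverse : ∀ n → ι (suc n) * recip n ≡ 1ℚ
  recip-inverse n = trans (*-comm (ι (suc n)) (recip n)) (/-ι (posℤ 1) (suc n))

  open ≡-Reasoning

  -- Sums and products over initial segments of the naturals.

  ∑< ∏< : ℕ → (ℕ → ℚ) → ℚ
  ∑< zero    f = 0ℚ
  ∑< (suc n) f = ∑< n f + f n
  ∏< zero    f = 1ℚ
  ∏< (suc n) f = ∏< n f * f n

  module _ (M : Monoid 0ℓ 0ℓ) where
    open Monoid M using (Carrier; _≈_; _∙_; reflexive) renaming (trans to ≈-trans)
    open MonoidSum M using (sum; sum-init-last; sum-cong-≗)

    -- Library sums and products peel off the first index, whereas all recurrences here add a last
    -- one. The monoid is abstract so that one proof serves both `∑<` and `pochhammer`.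
    sum-toℕ-last : ∀ n (f : ℕ → Carrier) →
      sum {suc n} (λ i → f (toℕ i)) ≈ sum {n} (λ i → f (toℕ i)) ∙ f n
    sum-toℕ-last n f = ≈-trans (sum-init-last {n} (λ i → f (toℕ i)))
      (reflexive (cong₂ _∙_ (sum-cong-≗ {n} (λ i → cong f (toℕ-inject₁ i))) (cong f (toℕ-fromℕ n))))

  open MonoidSum +-0-monoid using (sum-syntax)

  ∑-toℕ : ∀ n f → ∑[ i < n ] f (toℕ i) ≡ ∑< n f
  ∑-toℕ zero    f = refl
  ∑-toℕ (suc n) f = trans (sum-toℕ-last +-0-monoid n f) (cong (_+ f n) (∑-toℕ n f))

  pochhammer-∏ : ∀ a n → pochhammer a n ≡ ∏< n (λ k → a + ι k)
  pochhammer-∏ a zero    = refl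
  pochhammer-∏ a (suc n) = trans (sum-toℕ-last *-1-monoid n (λ k → a + ι k))
    (cong (_* (a + ι n)) (pochhammer-∏ a n))

  -- The WZ pair (φ , γ)

  -- Reciprocals are kept as products of their own, so that identities between quotients of
  -- factorials become polynomial identities in these values.
  F F⁻¹ H H⁻¹ : ℕ → ℚ
  F k = ι (k !)
  F⁻¹ k = ∏< k recip
  H k = ∏< k (λ i → ½ + ι i)
  H⁻¹ k = ∏< k (λ i → ι 2 * recip (2 ℕ.* i))

  F-suc : ∀ k → F (suc k) ≡ (ι k + 1ℚ) * F k
  F-suc k = trans (ι-* (suc k) (k !)) (cong (_* F k) (ι-suc k))

  F⁻¹-pred : ∀ k → F⁻¹ k ≡ (ι k + 1ℚ) * F⁻¹ (suc k)
  F⁻¹-pred k = sym (begin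
    (ι k + 1ℚ) * (F⁻¹ k * recip k) ≡⟨ swap (ι k + 1ℚ) (F⁻¹ k) (recip k) ⟩
    F⁻¹ k * ((ι k + 1ℚ) * recip k) ≡⟨ cong (λ x → F⁻¹ k * (x * recip k)) (ι-suc k) ⟨
    F⁻¹ k * (ι (suc k) * recip k)  ≡⟨ cong (F⁻¹ k *_) (recip-inverse k) ⟩
    F⁻¹ k * 1ℚ                     ≡⟨ *-identityʳ (F⁻¹ k) ⟩
    F⁻¹ k                          ∎)
    where
    swap : ∀ a b c → a * (b * c) ≡ b * (a * c)
    swap = solve-∀ ℚ-ring

  -- Opaque, so that the arguments can be inferred in the congruence lemmas below.
  -- The polynomial Λ is the WZ certificate, found by interpolation.
  opaque
    Λ : ℚ → ℚ → ℚ
    Λ M m = ι 3 * ((M + 1ℚ) * (M + ι 2) * (ι 2 * M + ι 3)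
      + m * (ι 8 * M * M * M + ι 38 * M * M + ι 58 * M + ι 29
        - ι 5 * m - ι 4 * M * m - ι 16 * m * m - ι 8 * M * m * m - ι 4 * m * m * m))

    φ-value : (m c f k i : ℚ) → ℚ
    φ-value m c f k i = ι 6 * (ι 4 * m + 1ℚ) * c * c * (f * k * i * i)

    γ-value : (M m c f k i : ℚ) → ℚ
    γ-value M m c f k i = c * c * (f * k * i * i) * Λ M m

  φ γ : ℕ → ℕ → ℚ
  φ M m = φ-value (ι m) (H m * F⁻¹ m) (F (M ℕ.+ m)) (H (M ∸ m)) (F⁻¹ M)
  γ M m = γ-value (ι M) (ι m) (H m * F⁻¹ m) (F (M ℕ.+ m)) (H (suc M ∸ m)) (F⁻¹ (2 ℕ.+ M))

  φ-cong : ∀ {m m′ c c′ f f′ k k′ i i′} → m ≡ m′ → c ≡ c′ → f ≡ f′ → k ≡ k′ → i ≡ i′ →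
    φ-value m c f k i ≡ φ-value m′ c′ f′ k′ i′
  φ-cong refl refl refl refl refl = refl

  γ-cong : ∀ {M M′ m m′ c c′ f f′ k k′ i i′} → M ≡ M′ → m ≡ m′ → c ≡ c′ → f ≡ f′ → k ≡ k′ → i ≡ i′ →
    γ-value M m c f k i ≡ γ-value M′ m′ c′ f′ k′ i′
  γ-cong refl refl refl refl refl refl = refl

  F-suc′ : ∀ k {x} → ι k ≡ x → F (suc k) ≡ (x + 1ℚ) * F k
  F-suc′ k refl = F-suc k

  ι-suc′ : ∀ k {x} → ι k ≡ x → ι (suc k) ≡ x + 1ℚ
  ι-suc′ k refl = ι-suc k

  F⁻¹-pred′ : ∀ k {x} → ι k ≡ x → F⁻¹ k ≡ (x + 1ℚ) * F⁻¹ (suc k)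
  F⁻¹-pred′ k refl = F⁻¹-pred k

  opaque
    unfolding φ-value

    -- Every shifted factorial is a polynomial multiple of one of `h` = (1/2)_m, `v` = 1/(m+1)!, `f`
    -- = (M+m)!, `k` = (1/2)_r and `w` = 1/(M+2)!. With `r` standing for M - m, the WZ equation is
    -- thus an identity of polynomials.
    wz-identity : ∀ (h v f k w m r : ℚ) →
      let M = m + r ; s = M + m ; n = m + 1ℚ ; d = h * (½ + m) * v ; c = h * (n * v)
          i = (M + 1ℚ) * ((M + 1ℚ + 1ℚ) * w) in
      φ-value n d ((s + 1ℚ + 1ℚ + 1ℚ) * ((s + 1ℚ + 1ℚ) * ((s + 1ℚ) * f))) (k * (½ + r)) w
        + γ-value M m c f (k * (½ + r)) w
      ≡ φ-value m c f k i + γ-value M n d ((s + 1ℚ) * f) k w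
    wz-identity = expanded
      where
      expanded : ∀ (h v f k w m r : ℚ) →
        let M = m + r ; s = M + m ; n = m + 1ℚ ; d = h * (½ + m) * v ; c = h * (n * v)
            i = (M + 1ℚ) * ((M + 1ℚ + 1ℚ) * w) in
        ι 6 * (ι 4 * n + 1ℚ) * d * d
            * ((s + 1ℚ + 1ℚ + 1ℚ) * ((s + 1ℚ + 1ℚ) * ((s + 1ℚ) * f)) * (k * (½ + r)) * w * w)
          + c * c * (f * (k * (½ + r)) * w * w) * (ι 3 * ((M + 1ℚ) * (M + ι 2) * (ι 2 * M + ι 3)
            + m * (ι 8 * M * M * M + ι 38 * M * M + ι 58 * M + ι 29
              - ι 5 * m - ι 4 * M * m - ι 16 * m * m - ι 8 * M * m * m - ι 4 * m * m * m)))
        ≡ ι 6 * (ι 4 * m + 1ℚ) * c * c * (f * k * i * i)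
          + d * d * ((s + 1ℚ) * f * k * w * w) * (ι 3 * ((M + 1ℚ) * (M + ι 2) * (ι 2 * M + ι 3)
            + n * (ι 8 * M * M * M + ι 38 * M * M + ι 58 * M + ι 29
              - ι 5 * n - ι 4 * M * n - ι 16 * n * n - ι 8 * M * n * n - ι 4 * n * n * n)))
      expanded = solve-∀ ℚ-ring

  -- The WZ shift is oblique: M advances by 2 while m advances by 1. This matches M = 2N-1 as N
  -- grows by 1 and lengthens the sum by one term at the same time.
  φ-γ-step : ∀ m r → φ (2 ℕ.+ (m ℕ.+ r)) (suc m) + γ (m ℕ.+ r) m
                   ≡ φ (m ℕ.+ r) m + γ (m ℕ.+ r) (suc m)
  φ-γ-step m r = begin
    φ (2 ℕ.+ M) (suc m) + γ M m ≡⟨ cong₂ _+_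
      (φ-cong (ι-suc m) refl F₃ (cong H 1+M∸m) refl)
      (γ-cong ιM refl c-eq refl (cong H 1+M∸m) refl) ⟩
    _ ≡⟨ wz-identity (H m) (F⁻¹ (suc m)) (F (M ℕ.+ m)) (H r) (F⁻¹ (2 ℕ.+ M)) (ι m) (ι r) ⟩
    _ ≡⟨ cong₂ _+_
      (φ-cong refl c-eq refl (cong H M∸m) (trans (F⁻¹-pred′ M ιM) (cong ((ι m + ι r + 1ℚ) *_) (F⁻¹-pred′ (suc M) (ι-suc′ M ιM)))))
      (γ-cong ιM (ι-suc m) refl F₁ (cong H M∸m) refl) ⟨
    φ M m + γ M (suc m) ∎
    where
    M = m ℕ.+ r
    ιM : ι M ≡ ι m + ι r
    ιM = ι-+ m r
    ιs : ι (M ℕ.+ m) ≡ ι m + ι r + ι m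
    ιs = trans (ι-+ M m) (cong (_+ ι m) ιM)
    M∸m : M ∸ m ≡ r
    M∸m = ℕₚ.m+n∸m≡n m r
    1+M∸m : suc M ∸ m ≡ suc r
    1+M∸m = trans (cong (_∸ m) (sym (ℕₚ.+-suc m r))) (ℕₚ.m+n∸m≡n m (suc r))
    c-eq : H m * F⁻¹ m ≡ H m * ((ι m + 1ℚ) * F⁻¹ (suc m))
    c-eq = cong (H m *_) (F⁻¹-pred m)
    s = ι m + ι r + ι m
    F₁ : F (M ℕ.+ suc m) ≡ (s + 1ℚ) * F (M ℕ.+ m)
    F₁ = trans (cong F (ℕₚ.+-suc M m)) (F-suc′ (M ℕ.+ m) ιs)
    F₃ : F (2 ℕ.+ M ℕ.+ suc m) ≡ (s + 1ℚ + 1ℚ + 1ℚ) * ((s + 1ℚ + 1ℚ) * ((s + 1ℚ) * F (M ℕ.+ m)))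
    F₃ = trans (cong (λ x → F (2 ℕ.+ x)) (ℕₚ.+-suc M m))
      (trans (F-suc′ (2 ℕ.+ (M ℕ.+ m)) (ι-suc′ (suc (M ℕ.+ m)) (ι-suc′ (M ℕ.+ m) ιs))) (cong ((s + 1ℚ + 1ℚ + 1ℚ) *_)
        (trans (F-suc′ (suc (M ℕ.+ m)) (ι-suc′ (M ℕ.+ m) ιs)) (cong ((s + 1ℚ + 1ℚ) *_) (F-suc′ (M ℕ.+ m) ιs)))))

  opaque
    unfolding φ-value

    φ-γ-base-identity : ∀ M f k w →
      φ-value 0ℚ 1ℚ ((M + 0ℚ + 1ℚ + 1ℚ) * ((M + 0ℚ + 1ℚ) * f)) (k * (½ + (M + 1ℚ))) w
      ≡ γ-value M 0ℚ 1ℚ f k w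
    φ-γ-base-identity = expanded
      where
      expanded : ∀ M f k w →
        ι 6 * (ι 4 * 0ℚ + 1ℚ) * 1ℚ * 1ℚ
          * ((M + 0ℚ + 1ℚ + 1ℚ) * ((M + 0ℚ + 1ℚ) * f) * (k * (½ + (M + 1ℚ))) * w * w)
        ≡ 1ℚ * 1ℚ * (f * k * w * w) * (ι 3 * ((M + 1ℚ) * (M + ι 2) * (ι 2 * M + ι 3)
          + 0ℚ * (ι 8 * M * M * M + ι 38 * M * M + ι 58 * M + ι 29
            - ι 5 * 0ℚ - ι 4 * M * 0ℚ - ι 16 * 0ℚ * 0ℚ - ι 8 * M * 0ℚ * 0ℚ - ι 4 * 0ℚ * 0ℚ * 0ℚ)))
      expanded = solve-∀ ℚ-ring

    -- With N = n+1, the certificate factors on the diagonal as Λ(2N-1,N) = 3N (2N+1)² (11N+3). This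
    -- is the origin of the linear factor of the theorem; 3N and 2N+1 are absorbed into (3N)! and
    -- 1/(2N+1)!.
    γ-diagonal-identity : ∀ h v f w n → let M = n + n + 1ℚ ; y = n + n + 1ℚ + 1ℚ in
      γ-value M (n + 1ℚ) (h * v) f h w
      ≡ (ι 11 * (n + 1ℚ) + ι 3) * h * ((n + n + 1ℚ + (n + 1ℚ) + 1ℚ) * f)
        * (v * v * (h * ((y + 1ℚ) * w)) * (h * ((y + 1ℚ) * w)))
    γ-diagonal-identity = expanded
      where
      expanded : ∀ h v f w n → let M = n + n + 1ℚ ; m = n + 1ℚ ; c = h * v ; y = n + n + 1ℚ + 1ℚ in
        c * c * (f * h * w * w) * (ι 3 * ((M + 1ℚ) * (M + ι 2) * (ι 2 * M + ι 3)
          + m * (ι 8 * M * M * M + ι 38 * M * M + ι 58 * M + ι 29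
            - ι 5 * m - ι 4 * M * m - ι 16 * m * m - ι 8 * M * m * m - ι 4 * m * m * m)))
        ≡ (ι 11 * (n + 1ℚ) + ι 3) * h * ((n + n + 1ℚ + (n + 1ℚ) + 1ℚ) * f)
          * (v * v * (h * ((y + 1ℚ) * w)) * (h * ((y + 1ℚ) * w)))
      expanded = solve-∀ ℚ-ring

    ∑t≡∑φ-base : ι 3 ≡ φ-value 0ℚ 1ℚ 1ℚ ½ 1ℚ
    ∑t≡∑φ-base = refl

  -- Formally the WZ step at m = -1, where φ(M,-1) and γ(M,-1) vanish because 1/(-1)! = 0.
  φ-γ-base : ∀ M → φ (2 ℕ.+ M) 0 ≡ γ M 0
  φ-γ-base M = trans
    (φ-cong refl refl
      (trans (F-suc′ (suc (M ℕ.+ 0)) (ι-suc′ (M ℕ.+ 0) (ι-+ M 0))) (cong ((ι M + 0ℚ + 1ℚ + 1ℚ) *_) (F-suc′ (M ℕ.+ 0) (ι-+ M 0))))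
      (cong (λ x → H (suc M) * (½ + x)) (ι-suc M)) refl)
    (φ-γ-base-identity (ι M) (F (M ℕ.+ 0)) (H (suc M)) (F⁻¹ (2 ℕ.+ M)))

  ∑φ-telescope : ∀ M j → j ≤ₙ M → ∑< (suc j) (φ (2 ℕ.+ M)) ≡ ∑< j (φ M) + γ M j
  ∑φ-telescope M zero    _   = cong (0ℚ +_) (φ-γ-base M)
  ∑φ-telescope M (suc j) j<M = begin
    ∑< (suc j) (φ (2 ℕ.+ M)) + φ (2 ℕ.+ M) (suc j)  ≡⟨ cong (_+ φ (2 ℕ.+ M) (suc j)) (∑φ-telescope M j j≤M) ⟩
    ∑< j (φ M) + γ M j + φ (2 ℕ.+ M) (suc j)        ≡⟨ shuffle (∑< j (φ M)) (γ M j) _ ⟩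
    ∑< j (φ M) + (φ (2 ℕ.+ M) (suc j) + γ M j)      ≡⟨ cong (∑< j (φ M) +_) step ⟩
    ∑< j (φ M) + (φ M j + γ M (suc j))              ≡⟨ +-assoc (∑< j (φ M)) _ _ ⟨
    ∑< j (φ M) + φ M j + γ M (suc j)                ∎
    where
    j≤M : j ≤ₙ M
    j≤M = ℕₚ.<⇒≤ j<M
    step : φ (2 ℕ.+ M) (suc j) + γ M j ≡ φ M j + γ M (suc j)
    step = subst (λ x → φ (2 ℕ.+ x) (suc j) + γ x j ≡ φ x j + γ x (suc j))
      (ℕₚ.m+[n∸m]≡n j≤M) (φ-γ-step j (M ∸ j))
    shuffle : ∀ a b c → a + b + c ≡ a + (c + b)
    shuffle = solve-∀ ℚ-ring

  -- The summand as the diagonal of `γ`.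

  ¼ : ℚ
  ¼ = ½ * ½

  ¼^ : ℕ → ℚ
  ¼^ n = ∏< n (λ _ → ¼)

  -- The common form (11n+3) (1/2)_n (3n)! / (n!⁴ 16^n) of both summands. The factor 1/(n! 4^n) is
  -- left standing twice because it arises from the square of (1/2)_n / (2n)!.
  t : ℕ → ℚ
  t n = (ι 11 * ι n + ι 3) * H n * F (n ℕ.+ n ℕ.+ n) * (F⁻¹ n * F⁻¹ n * (F⁻¹ n * ¼^ n) * (F⁻¹ n * ¼^ n))

  -- The duplication formula (2n)! = 4^n n! (1/2)_n, in reciprocal form.
  H-F⁻¹-double : ∀ n → H n * F⁻¹ (n ℕ.+ n) ≡ F⁻¹ n * ¼^ n
  H-F⁻¹-double zero    = refl
  H-F⁻¹-double (suc n) = begin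
    H n * (½ + x) * F⁻¹ (suc n ℕ.+ suc n)                       ≡⟨ cong (λ k → H n * (½ + x) * F⁻¹ (suc k)) (ℕₚ.+-suc n n) ⟩
    H n * (½ + x) * w                                           ≡⟨ *-identityʳ _ ⟨
    H n * (½ + x) * w * 1ℚ                                      ≡⟨ cong (H n * (½ + x) * w *_) (trans (cong (_* recip n) (sym (ι-suc n))) (recip-inverse n)) ⟨
    H n * (½ + x) * w * ((x + 1ℚ) * recip n)                    ≡⟨ identity (H n) x w (recip n) ⟩
    H n * ((x + x + 1ℚ) * ((x + x + 1ℚ + 1ℚ) * w)) * recip n * ¼ ≡⟨ cong (λ y → H n * y * recip n * ¼)
      (trans (F⁻¹-pred′ (n ℕ.+ n) (ι-+ n n)) (cong ((x + x + 1ℚ) *_) (F⁻¹-pred′ (suc (n ℕ.+ n)) (ι-suc′ (n ℕ.+ n) (ι-+ n n))))) ⟨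
    H n * F⁻¹ (n ℕ.+ n) * recip n * ¼                           ≡⟨ cong (λ y → y * recip n * ¼) (H-F⁻¹-double n) ⟩
    F⁻¹ n * ¼^ n * recip n * ¼                                  ≡⟨ shuffle (F⁻¹ n) (¼^ n) (recip n) ¼ ⟩
    F⁻¹ n * recip n * (¼^ n * ¼)                                ∎
    where
    x = ι n
    w = F⁻¹ (suc (suc (n ℕ.+ n)))
    identity : ∀ h x w r → h * (½ + x) * w * ((x + 1ℚ) * r)
      ≡ h * ((x + x + 1ℚ) * ((x + x + 1ℚ + 1ℚ) * w)) * r * (½ * ½)
    identity = solve-∀ ℚ-ring
    shuffle : ∀ a b c d → a * b * c * d ≡ a * c * (b * d)
    shuffle = solve-∀ ℚ-ring

  γ-diagonal : ∀ n → γ (suc (n ℕ.+ n)) (suc n) ≡ t (suc n)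
  γ-diagonal n = begin
    γ M N ≡⟨ γ-cong (ι-suc′ (n ℕ.+ n) (ι-+ n n)) (ι-suc n) refl refl (cong H 1+M∸N) refl ⟩
    _ ≡⟨ γ-diagonal-identity (H N) (F⁻¹ N) (F (M ℕ.+ N)) w (ι n) ⟩
    (ι 11 * (ι n + 1ℚ) + ι 3) * H N * ((x + 1ℚ) * F (M ℕ.+ N))
      * (F⁻¹ N * F⁻¹ N * (H N * ((y + 1ℚ) * w)) * (H N * ((y + 1ℚ) * w)))
      ≡⟨ cong₂ (λ a b → (ι 11 * a + ι 3) * H N * b * (F⁻¹ N * F⁻¹ N * (H N * ((y + 1ℚ) * w)) * (H N * ((y + 1ℚ) * w))))
         (sym (ι-suc n)) (trans (sym (F-suc′ (M ℕ.+ N) ι3n+2)) (cong F (cong (ℕ._+ N) 1+M))) ⟩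
    (ι 11 * ι N + ι 3) * H N * F (N ℕ.+ N ℕ.+ N) * (F⁻¹ N * F⁻¹ N * (H N * ((y + 1ℚ) * w)) * (H N * ((y + 1ℚ) * w)))
      ≡⟨ cong (λ a → (ι 11 * ι N + ι 3) * H N * F (N ℕ.+ N ℕ.+ N) * (F⁻¹ N * F⁻¹ N * a * a)) HF ⟩
    t N ∎
    where
    N = suc n
    M = suc (n ℕ.+ n)
    w = F⁻¹ (2 ℕ.+ M)
    x = ι n + ι n + 1ℚ + (ι n + 1ℚ)
    y = ι n + ι n + 1ℚ + 1ℚ
    1+M : suc M ≡ N ℕ.+ N
    1+M = cong suc (sym (ℕₚ.+-suc n n))
    1+M∸N : suc M ∸ N ≡ N
    1+M∸N = trans (cong (_∸ N) 1+M) (ℕₚ.m+n∸m≡n N N)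
    ι3n+2 : ι (M ℕ.+ N) ≡ x
    ι3n+2 = trans (ι-+ M N) (cong₂ _+_ (ι-suc′ (n ℕ.+ n) (ι-+ n n)) (ι-suc n))
    HF : H N * ((y + 1ℚ) * w) ≡ F⁻¹ N * ¼^ N
    HF = trans (cong (H N *_) (trans (sym (F⁻¹-pred′ (suc M) (ι-suc′ M (ι-suc′ (n ℕ.+ n) (ι-+ n n))))) (cong F⁻¹ 1+M))) (H-F⁻¹-double N)

  ∑t≡∑φ : ∀ n → ∑< (suc n) t ≡ ∑< (suc n) (φ (suc (n ℕ.+ n)))
  ∑t≡∑φ zero    = cong (0ℚ +_) ∑t≡∑φ-base
  ∑t≡∑φ (suc n) = begin
    ∑< (suc n) t + t (suc n)                                      ≡⟨ cong₂ _+_ (∑t≡∑φ n) (sym (γ-diagonal n)) ⟩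
    ∑< (suc n) (φ (suc (n ℕ.+ n))) + γ (suc (n ℕ.+ n)) (suc n)    ≡⟨ ∑φ-telescope (suc (n ℕ.+ n)) (suc n) (s≤s (ℕₚ.m≤m+n n n)) ⟨
    ∑< (suc (suc n)) (φ (suc (suc (suc (n ℕ.+ n)))))              ≡⟨ cong (λ k → ∑< (suc (suc n)) (φ (suc (suc k)))) (ℕₚ.+-suc n n) ⟨
    ∑< (suc (suc n)) (φ (suc (suc n ℕ.+ suc n)))                  ∎

  -- The binomial and the Pochhammer form of the summand.

  F-F⁻¹ : ∀ n → F n * F⁻¹ n ≡ 1ℚ
  F-F⁻¹ zero    = refl
  F-F⁻¹ (suc n) = begin
    F (suc n) * F⁻¹ (suc n)             ≡⟨ cong (_* F⁻¹ (suc n)) (ι-* (suc n) (n !)) ⟩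
    ι (suc n) * F n * (F⁻¹ n * recip n) ≡⟨ shuffle (ι (suc n)) (F n) (F⁻¹ n) (recip n) ⟩
    F n * F⁻¹ n * (ι (suc n) * recip n) ≡⟨ cong₂ _*_ (F-F⁻¹ n) (recip-inverse n) ⟩
    1ℚ                                  ∎
    where
    shuffle : ∀ a b c d → a * b * (c * d) ≡ b * c * (a * d)
    shuffle = solve-∀ ℚ-ring

  unique-quotient : ∀ {x y y⁻¹ z : ℚ} → y * y⁻¹ ≡ 1ℚ → x * y ≡ z → x ≡ z * y⁻¹
  unique-quotient {x} {y} {y⁻¹} {z} inv eq = begin
    x             ≡⟨ *-identityʳ x ⟨
    x * 1ℚ        ≡⟨ cong (x *_) inv ⟨
    x * (y * y⁻¹) ≡⟨ *-assoc x y y⁻¹ ⟨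
    x * y * y⁻¹   ≡⟨ cong (_* y⁻¹) eq ⟩
    z * y⁻¹       ∎

  ι-C : ∀ n k → ι ((n ℕ.+ k) C k) ≡ F (n ℕ.+ k) * (F⁻¹ k * F⁻¹ n)
  ι-C n k = unique-quotient
    (trans (shuffle (F k) (F n) (F⁻¹ k) (F⁻¹ n)) (cong₂ _*_ (F-F⁻¹ k) (F-F⁻¹ n)))
    (trans (cong (ι ((n ℕ.+ k) C k) *_) (sym (ι-* (k !) (n !))))
      (trans (sym (ι-* ((n ℕ.+ k) C k) (k ! ℕ.* n !))) (cong ι eq)))
    where
    shuffle : ∀ a b c d → a * b * (c * d) ≡ a * c * (b * d)
    shuffle = solve-∀ ℚ-ring
    k≤n+k : k ≤ₙ n ℕ.+ k
    k≤n+k = ℕₚ.m≤n+m k n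
    instance nz : ℕ.NonZero (k ! ℕ.* (n ℕ.+ k ∸ k) !)
             nz = k ℕₚ.!* (n ℕ.+ k ∸ k) !≢0
    eq : ((n ℕ.+ k) C k) ℕ.* (k ! ℕ.* n !) ≡ (n ℕ.+ k) !
    eq = begin
      ((n ℕ.+ k) C k) ℕ.* (k ! ℕ.* n !)
        ≡⟨ cong (λ x → ((n ℕ.+ k) C k) ℕ.* (k ! ℕ.* x !)) (ℕₚ.m+n∸n≡m n k) ⟨
      ((n ℕ.+ k) C k) ℕ.* (k ! ℕ.* (n ℕ.+ k ∸ k) !)
        ≡⟨ cong (ℕ._* (k ! ℕ.* (n ℕ.+ k ∸ k) !)) (nCk≡n!/k![n-k]! k≤n+k) ⟩
      _ ≡⟨ m/n*n≡m (k![n∸k]!∣n! k≤n+k) ⟩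
      (n ℕ.+ k) ! ∎

  F-double : ∀ n → F (n ℕ.+ n) * ¼^ n ≡ H n * F n
  F-double n = begin
    F (n ℕ.+ n) * ¼^ n                            ≡⟨ *-identityˡ _ ⟨
    1ℚ * (F (n ℕ.+ n) * ¼^ n)                     ≡⟨ cong (_* (F (n ℕ.+ n) * ¼^ n)) (F-F⁻¹ n) ⟨
    F n * F⁻¹ n * (F (n ℕ.+ n) * ¼^ n)            ≡⟨ s₁ (F n) (F⁻¹ n) (F (n ℕ.+ n)) (¼^ n) ⟩
    F⁻¹ n * ¼^ n * (F n * F (n ℕ.+ n))            ≡⟨ cong (_* (F n * F (n ℕ.+ n))) (H-F⁻¹-double n) ⟨
    H n * F⁻¹ (n ℕ.+ n) * (F n * F (n ℕ.+ n))     ≡⟨ s₂ (H n) (F⁻¹ (n ℕ.+ n)) (F n) (F (n ℕ.+ n)) ⟩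
    H n * F n * (F (n ℕ.+ n) * F⁻¹ (n ℕ.+ n))     ≡⟨ cong (H n * F n *_) (F-F⁻¹ (n ℕ.+ n)) ⟩
    H n * F n * 1ℚ                                ≡⟨ *-identityʳ _ ⟩
    H n * F n                                     ∎
    where
    s₁ : ∀ a b c d → a * b * (c * d) ≡ b * d * (a * c)
    s₁ = solve-∀ ℚ-ring
    s₂ : ∀ a b c d → a * b * (c * d) ≡ a * c * (d * b)
    s₂ = solve-∀ ℚ-ring

  64^-¼^ : ∀ n → ι (64 ℕ.^ n) * (¼^ n * ¼^ n * ¼^ n) ≡ 1ℚ
  64^-¼^ zero    = refl
  64^-¼^ (suc n) = begin
    ι (64 ℕ.* 64 ℕ.^ n) * (q * ¼ * (q * ¼) * (q * ¼))  ≡⟨ cong (_* (q * ¼ * (q * ¼) * (q * ¼))) (ι-* 64 (64 ℕ.^ n)) ⟩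
    ι 64 * ι (64 ℕ.^ n) * (q * ¼ * (q * ¼) * (q * ¼))  ≡⟨ identity (ι (64 ℕ.^ n)) q ⟩
    ι (64 ℕ.^ n) * (q * q * q)                         ≡⟨ 64^-¼^ n ⟩
    1ℚ                                                 ∎
    where
    q = ¼^ n
    identity : ∀ x q → ι 64 * x * (q * (½ * ½) * (q * (½ * ½)) * (q * (½ * ½))) ≡ x * (q * q * q)
    identity = solve-∀ ℚ-ring

  ι-11n+3 : ∀ n → ι (11 ℕ.* n ℕ.+ 3) ≡ ι 11 * ι n + ι 3
  ι-11n+3 n = trans (ι-+ (11 ℕ.* n) 3) (cong (_+ ι 3) (ι-* 11 n))

  2*n≡n+n : ∀ n → 2 ℕ.* n ≡ n ℕ.+ n
  2*n≡n+n n = cong (n ℕ.+_) (ℕₚ.+-identityʳ n)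

  3*n≡n+n+n : ∀ n → 3 ℕ.* n ≡ n ℕ.+ n ℕ.+ n
  3*n≡n+n+n n = trans (cong (n ℕ.+_) (2*n≡n+n n)) (sym (ℕₚ.+-assoc n n n))

  binomialTerm≡t : ∀ n → binomialTerm n ≡ t n
  binomialTerm≡t n = begin
    binomialTerm n ≡⟨ cong₂ _*_ (cong₂ _*_ quotient square) cubic ⟩
    (ι 11 * ι n + ι 3) * (q * q * q) * (c * c) * (f * (v * w))   ≡⟨ s₁ (ι 11 * ι n + ι 3) q (F (n ℕ.+ n)) v f w ⟩
    a * f * (v * v * v * v) * (v * q) * q * (F (n ℕ.+ n) * q) * (F (n ℕ.+ n) * w) ≡⟨ cong₂ (λ x y → a * f * (v * v * v * v) * (v * q) * q * x * y) (F-double n) (F-F⁻¹ (n ℕ.+ n)) ⟩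
    a * f * (v * v * v * v) * (v * q) * q * (H n * F n) * 1ℚ         ≡⟨ s₂ a f v q (H n) (F n) ⟩
    a * H n * f * (v * v * (v * q) * (v * q)) * (F n * v)        ≡⟨ cong (t n *_) (F-F⁻¹ n) ⟩
    t n * 1ℚ                                                     ≡⟨ *-identityʳ (t n) ⟩
    t n ∎
    where
    q = ¼^ n
    v = F⁻¹ n
    w = F⁻¹ (n ℕ.+ n)
    f = F (n ℕ.+ n ℕ.+ n)
    a = ι 11 * ι n + ι 3
    c = F (n ℕ.+ n) * (v * v)
    quotient : (posℤ (11 ℕ.* n ℕ.+ 3) / (64 ℕ.^ n)) {{ℕₚ.m^n≢0 64 n}} ≡ a * (q * q * q)
    quotient = unique-quotient (64^-¼^ n)
      (trans (/-ι (posℤ (11 ℕ.* n ℕ.+ 3)) (64 ℕ.^ n) {{ℕₚ.m^n≢0 64 n}}) (ι-11n+3 n))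
    square : ι (((2 ℕ.* n) C n) ℕ.^ 2) ≡ c * c
    square = begin
      ι (((2 ℕ.* n) C n) ℕ.^ 2)               ≡⟨ cong (λ x → ι ((x C n) ℕ.^ 2)) (2*n≡n+n n) ⟩
      ι (b ℕ.* (b ℕ.* 1))                     ≡⟨ cong (λ x → ι (b ℕ.* x)) (ℕₚ.*-identityʳ b) ⟩
      ι (b ℕ.* b)                             ≡⟨ ι-* b b ⟩
      ι b * ι b                               ≡⟨ cong₂ _*_ (ι-C n n) (ι-C n n) ⟩
      c * c                                   ∎
      where b = (n ℕ.+ n) C n
    cubic : ι ((3 ℕ.* n) C n) ≡ f * (v * w)
    cubic = trans (cong (λ x → ι (x C n)) (3*n≡n+n+n n)) (ι-C (n ℕ.+ n) n)
    s₁ : ∀ a q d v f w → a * (q * q * q) * (d * (v * v) * (d * (v * v))) * (f * (v * w))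
      ≡ a * f * (v * v * v * v) * (v * q) * q * (d * q) * (d * w)
    s₁ = solve-∀ ℚ-ring
    s₂ : ∀ a f v q h g → a * f * (v * v * v * v) * (v * q) * q * (h * g) * 1ℚ
      ≡ a * h * f * (v * v * (v * q) * (v * q)) * (g * v)
    s₂ = solve-∀ ℚ-ring

  ⅓ ⅔ : ℚ
  ⅓ = posℤ 1 / 3
  ⅔ = posℤ 2 / 3

  pochhammer-suc : ∀ a n → pochhammer a (suc n) ≡ pochhammer a n * (a + ι n)
  pochhammer-suc a n = begin
    pochhammer a (suc n)                  ≡⟨ pochhammer-∏ a (suc n) ⟩
    ∏< n (λ k → a + ι k) * (a + ι n)      ≡⟨ cong (_* (a + ι n)) (pochhammer-∏ a n) ⟨
    pochhammer a n * (a + ι n)            ∎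

  pochhammer-1 : ∀ n → pochhammer 1ℚ n ≡ F n
  pochhammer-1 zero    = refl
  pochhammer-1 (suc n) = begin
    pochhammer 1ℚ (suc n)          ≡⟨ pochhammer-suc 1ℚ n ⟩
    pochhammer 1ℚ n * (1ℚ + ι n)   ≡⟨ cong₂ _*_ (pochhammer-1 n) (+-comm 1ℚ (ι n)) ⟩
    F n * (ι n + 1ℚ)               ≡⟨ *-comm (F n) (ι n + 1ℚ) ⟩
    (ι n + 1ℚ) * F n               ≡⟨ F-suc n ⟨
    F (suc n)                      ∎

  -- The triplication formula (3n)! = 27^n n! (1/3)_n (2/3)_n; the denominator 16 of the base
  -- supplies the two powers of 1/4.
  F-triple : ∀ n → pochhammer ⅓ n * pochhammer ⅔ n * (posℤ 27 / 16) ^ n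
               ≡ F (n ℕ.+ n ℕ.+ n) * (F⁻¹ n * ¼^ n * ¼^ n)
  F-triple zero    = refl
  F-triple (suc n) = begin
    pochhammer ⅓ (suc n) * pochhammer ⅔ (suc n) * (z * z ^ n)
      ≡⟨ cong₂ (λ a b → a * b * (z * z ^ n)) (pochhammer-suc ⅓ n) (pochhammer-suc ⅔ n) ⟩
    pochhammer ⅓ n * (⅓ + x) * (pochhammer ⅔ n * (⅔ + x)) * (z * z ^ n)
      ≡⟨ s₁ (pochhammer ⅓ n) (pochhammer ⅔ n) (z ^ n) x ⟩
    pochhammer ⅓ n * pochhammer ⅔ n * z ^ n * ((⅓ + x) * (⅔ + x) * z) * 1ℚ
      ≡⟨ cong₂ (λ a b → a * ((⅓ + x) * (⅔ + x) * z) * b) (F-triple n)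
          (sym (trans (cong (_* recip n) (sym (ι-suc n))) (recip-inverse n))) ⟩
    F 3n * (F⁻¹ n * ¼^ n * ¼^ n) * ((⅓ + x) * (⅔ + x) * z) * ((x + 1ℚ) * recip n)
      ≡⟨ s₂ (F 3n) (F⁻¹ n) (¼^ n) x (recip n) ⟩
    (y + 1ℚ + 1ℚ + 1ℚ) * ((y + 1ℚ + 1ℚ) * ((y + 1ℚ) * F 3n)) * (F⁻¹ n * recip n * (¼^ n * ¼) * (¼^ n * ¼))
      ≡⟨ cong (_* (F⁻¹ (suc n) * ¼^ (suc n) * ¼^ (suc n))) F₃ ⟨
    F (suc n ℕ.+ suc n ℕ.+ suc n) * (F⁻¹ (suc n) * ¼^ (suc n) * ¼^ (suc n)) ∎
    where
    z = posℤ 27 / 16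
    x = ι n
    3n = n ℕ.+ n ℕ.+ n
    y = x + x + x
    ι3n : ι 3n ≡ y
    ι3n = trans (ι-+ (n ℕ.+ n) n) (cong (_+ x) (ι-+ n n))
    index : suc n ℕ.+ suc n ℕ.+ suc n ≡ 3 ℕ.+ 3n
    index = trans (cong (λ k → suc (k ℕ.+ suc n)) (ℕₚ.+-suc n n)) (cong (λ k → suc (suc k)) (ℕₚ.+-suc (n ℕ.+ n) n))
    F₃ : F (suc n ℕ.+ suc n ℕ.+ suc n) ≡ (y + 1ℚ + 1ℚ + 1ℚ) * ((y + 1ℚ + 1ℚ) * ((y + 1ℚ) * F 3n))
    F₃ = trans (cong F index)
      (trans (F-suc′ (2 ℕ.+ 3n) (ι-suc′ (suc 3n) (ι-suc′ 3n ι3n))) (cong ((y + 1ℚ + 1ℚ + 1ℚ) *_)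
        (trans (F-suc′ (suc 3n) (ι-suc′ 3n ι3n)) (cong ((y + 1ℚ + 1ℚ) *_) (F-suc′ 3n ι3n)))))
    s₁ : ∀ a b c x → a * ((posℤ 1 / 3) + x) * (b * ((posℤ 2 / 3) + x)) * ((posℤ 27 / 16) * c)
      ≡ a * b * c * (((posℤ 1 / 3) + x) * ((posℤ 2 / 3) + x) * (posℤ 27 / 16)) * 1ℚ
    s₁ = solve-∀ ℚ-ring
    s₂ : ∀ f v q x r → let y = x + x + x in
      f * (v * q * q) * (((posℤ 1 / 3) + x) * ((posℤ 2 / 3) + x) * (posℤ 27 / 16)) * ((x + 1ℚ) * r)
      ≡ (y + 1ℚ + 1ℚ + 1ℚ) * ((y + 1ℚ + 1ℚ) * ((y + 1ℚ) * f)) * (v * r * (q * (½ * ½)) * (q * (½ * ½)))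
    s₂ = solve-∀ ℚ-ring

  pochhammerTerm≡t : ∀ n → pochhammerTerm n ≡ t n
  pochhammerTerm≡t n = begin
    pochhammerTerm n                                           ≡⟨ cong₂ (λ x y → x * y * z ^ n) quotient (ι-11n+3 n) ⟩
    H n * b * c * (v * v * v) * a * z ^ n                      ≡⟨ s₁ (H n) b c v a (z ^ n) ⟩
    a * H n * (b * c * z ^ n) * (v * v * v)                    ≡⟨ cong (λ x → a * H n * x * (v * v * v)) (F-triple n) ⟩
    a * H n * (F (n ℕ.+ n ℕ.+ n) * (v * q * q)) * (v * v * v)  ≡⟨ s₂ (a * H n) (F (n ℕ.+ n ℕ.+ n)) v q ⟩
    t n                                                        ∎
    where
    a = ι 11 * ι n + ι 3
    b = pochhammer ⅓ n
    c = pochhammer ⅔ n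
    q = ¼^ n
    v = F⁻¹ n
    z = posℤ 27 / 16
    g = pochhammer 1ℚ n
    instance g³≢0 : NonZero (g ^ 3)
             g³≢0 = pochhammer-1-cubed-nonZero n
    g³ : g ^ 3 * (v * v * v) ≡ 1ℚ
    g³ = trans (cong (λ x → x ^ 3 * (v * v * v)) (pochhammer-1 n))
      (trans (s₃ (F n) v) (cong (λ x → x * x * x) (F-F⁻¹ n)))
      where
      s₃ : ∀ f v → f * (f * (f * 1ℚ)) * (v * v * v) ≡ f * v * (f * v) * (f * v)
      s₃ = solve-∀ ℚ-ring
    num = pochhammer ½ n * b * c
    quotient : num ÷ (g ^ 3) ≡ H n * b * c * (v * v * v)
    quotient = unique-quotient g³ (begin
      num * 1/ (g ^ 3) * g ^ 3    ≡⟨ *-assoc num (1/ (g ^ 3)) (g ^ 3) ⟩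
      num * (1/ (g ^ 3) * g ^ 3)  ≡⟨ cong (num *_) (*-inverseˡ (g ^ 3)) ⟩
      num * 1ℚ                    ≡⟨ *-identityʳ num ⟩
      num                         ≡⟨ cong (λ x → x * b * c) (pochhammer-∏ ½ n) ⟩
      H n * b * c                 ∎)
    s₁ : ∀ h b c v a z → h * b * c * (v * v * v) * a * z ≡ a * h * (b * c * z) * (v * v * v)
    s₁ = solve-∀ ℚ-ring
    s₂ : ∀ a f v q → a * (f * (v * q * q)) * (v * v * v) ≡ a * f * (v * v * (v * q) * (v * q))
    s₂ = solve-∀ ℚ-ring

  -- Dougall's summation

  ½+-inverse : ∀ k → (½ + ι k) * (ι 2 * recip (2 ℕ.* k)) ≡ 1ℚ
  ½+-inverse k = begin
    (½ + ι k) * (ι 2 * recip (2 ℕ.* k))     ≡⟨ identity (ι k) (recip (2 ℕ.* k)) ⟩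
    (ι 2 * ι k + 1ℚ) * recip (2 ℕ.* k)      ≡⟨ cong (_* recip (2 ℕ.* k)) (ι-suc′ (2 ℕ.* k) (ι-* 2 k)) ⟨
    ι (suc (2 ℕ.* k)) * recip (2 ℕ.* k)     ≡⟨ recip-inverse (2 ℕ.* k) ⟩
    1ℚ                                      ∎
    where
    identity : ∀ x r → (½ + x) * (ι 2 * r) ≡ (ι 2 * x + 1ℚ) * r
    identity = solve-∀ ℚ-ring

  H⁻¹-pred′ : ∀ k {x} → ι k ≡ x → H⁻¹ k ≡ (½ + x) * H⁻¹ (suc k)
  H⁻¹-pred′ k refl = sym (begin
    (½ + ι k) * (H⁻¹ k * r)   ≡⟨ swap (½ + ι k) (H⁻¹ k) r ⟩
    H⁻¹ k * ((½ + ι k) * r)   ≡⟨ cong (H⁻¹ k *_) (½+-inverse k) ⟩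
    H⁻¹ k * 1ℚ                ≡⟨ *-identityʳ (H⁻¹ k) ⟩
    H⁻¹ k                     ∎)
    where
    r = ι 2 * recip (2 ℕ.* k)
    swap : ∀ a b c → a * (b * c) ≡ b * (a * c)
    swap = solve-∀ ℚ-ring

  H-H⁻¹ : ∀ k → H k * H⁻¹ k ≡ 1ℚ
  H-H⁻¹ zero    = refl
  H-H⁻¹ (suc k) = begin
    H k * (½ + ι k) * (H⁻¹ k * r)     ≡⟨ shuffle (H k) (½ + ι k) (H⁻¹ k) r ⟩
    H k * H⁻¹ k * ((½ + ι k) * r)     ≡⟨ cong₂ _*_ (H-H⁻¹ k) (½+-inverse k) ⟩
    1ℚ                                ∎
    where
    r = ι 2 * recip (2 ℕ.* k)
    shuffle : ∀ a b c d → a * b * (c * d) ≡ a * c * (b * d)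
    shuffle = solve-∀ ℚ-ring

  ∑<-linear : ∀ n y f g → ∑< n (λ m → y * f m + g m) ≡ y * ∑< n f + ∑< n g
  ∑<-linear zero    y f g = sym (trans (+-identityʳ (y * 0ℚ)) (*-zeroʳ y))
  ∑<-linear (suc n) y f g = trans (cong (_+ (y * f n + g n)) (∑<-linear n y f g))
    (shuffle y (∑< n f) (∑< n g) (f n) (g n))
    where
    shuffle : ∀ y a b c d → y * a + b + (y * c + d) ≡ y * (a + c) + (b + d)
    shuffle = solve-∀ ℚ-ring

  -- The sign is a product so that `∏<-*` can merge it with other products factor by factor.
  sgn : ℕ → ℚ
  sgn k = ∏< k (λ _ → - 1ℚ)

  opaque
    D-value : (σ b m h i f k : ℚ) → ℚ
    D-value σ b m h i f k = σ * b * (ι 4 * m + 1ℚ) * h * i * f * k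

    G-value : (σ b m h i f k : ℚ) → ℚ
    G-value σ b m h i f k = σ * b * (ι 2 * m + 1ℚ) * h * i * f * k

  -- `D` is the term of Dougall's series at -1 with a = 1/2, b = -n, c = M+1, multiplied by M!
  -- (1/2)_M / (1/2)_{n+1}. For m ≤ n ≤ M one has (-n)_m = (-1)^m n!/(n-m)!, and (1/2-M)_m has
  -- become (1/2)_{M-m}. `G` is its WZ certificate for the recurrence in n.
  D G : ℕ → ℕ → ℕ → ℚ
  D M n m = D-value (sgn m) (F n * F⁻¹ m * F⁻¹ (n ∸ m)) (ι m) (H m) (H⁻¹ (suc (m ℕ.+ n))) (F (M ℕ.+ m)) (H (M ∸ m))
  G M n m = G-value (sgn m) (F n * F⁻¹ m * F⁻¹ (n ∸ m)) (ι m) (H m) (H⁻¹ (2 ℕ.+ (m ℕ.+ n))) (F (suc (M ℕ.+ m))) (H (M ∸ m))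

  D-cong : ∀ {σ σ′ b b′ m m′ h h′ i i′ f f′ k k′} → σ ≡ σ′ → b ≡ b′ → m ≡ m′ → h ≡ h′ → i ≡ i′ → f ≡ f′ → k ≡ k′ →
    D-value σ b m h i f k ≡ D-value σ′ b′ m′ h′ i′ f′ k′
  D-cong refl refl refl refl refl refl refl = refl

  G-cong : ∀ {σ σ′ b b′ m m′ h h′ i i′ f f′ k k′} → σ ≡ σ′ → b ≡ b′ → m ≡ m′ → h ≡ h′ → i ≡ i′ → f ≡ f′ → k ≡ k′ →
    G-value σ b m h i f k ≡ G-value σ′ b′ m′ h′ i′ f′ k′
  G-cong refl refl refl refl refl refl refl = refl

  opaque
    unfolding D-value

    D-G-base-identity : ∀ (M n g w i f k : ℚ) →
      (M - n - ½) * D-value 1ℚ ((n + 1ℚ) * g * 1ℚ * w) 0ℚ 1ℚ i f k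
        + D-value 1ℚ (g * 1ℚ * ((n + 1ℚ) * w)) 0ℚ 1ℚ ((½ + (n + 1ℚ)) * i) f k
      ≡ G-value 1ℚ (g * 1ℚ * ((n + 1ℚ) * w)) 0ℚ 1ℚ i ((M + 1ℚ) * f) k
    D-G-base-identity = expanded
      where
      expanded : ∀ (M n g w i f k : ℚ) →
        (M - n - ½) * (1ℚ * ((n + 1ℚ) * g * 1ℚ * w) * (ι 4 * 0ℚ + 1ℚ) * 1ℚ * i * f * k)
          + 1ℚ * (g * 1ℚ * ((n + 1ℚ) * w)) * (ι 4 * 0ℚ + 1ℚ) * 1ℚ * ((½ + (n + 1ℚ)) * i) * f * k
        ≡ 1ℚ * (g * 1ℚ * ((n + 1ℚ) * w)) * (ι 2 * 0ℚ + 1ℚ) * 1ℚ * i * ((M + 1ℚ) * f) * k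
      expanded = solve-∀ ℚ-ring

    -- The variables e and r stand for n - m and M - m, where m = j + 1.
    D-G-step-identity : ∀ (σ g v w h i f k j e r : ℚ) →
      let m = j + 1ℚ ; n = m + e ; M = m + r ; s = m + n + 1ℚ in
      G-value σ (g * ((j + 1ℚ) * v) * w) j h ((½ + s) * i) f (k * (½ + r))
        + ((M - n - ½) * D-value (σ * - 1ℚ) ((n + 1ℚ) * g * v * w) m (h * (½ + j)) i f k
          + D-value (σ * - 1ℚ) (g * v * ((e + 1ℚ) * w)) m (h * (½ + j)) ((½ + s) * i) f k)
      ≡ G-value (σ * - 1ℚ) (g * v * ((e + 1ℚ) * w)) m (h * (½ + j)) i ((M + m + 1ℚ) * f) k
    D-G-step-identity = expanded
      where
      expanded : ∀ (σ g v w h i f k j e r : ℚ) →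
        let m = j + 1ℚ ; n = m + e ; M = m + r ; s = m + n + 1ℚ in
        σ * (g * ((j + 1ℚ) * v) * w) * (ι 2 * j + 1ℚ) * h * ((½ + s) * i) * f * (k * (½ + r))
          + ((M - n - ½) * (σ * - 1ℚ * ((n + 1ℚ) * g * v * w) * (ι 4 * m + 1ℚ) * (h * (½ + j)) * i * f * k)
            + σ * - 1ℚ * (g * v * ((e + 1ℚ) * w)) * (ι 4 * m + 1ℚ) * (h * (½ + j)) * ((½ + s) * i) * f * k)
        ≡ σ * - 1ℚ * (g * v * ((e + 1ℚ) * w)) * (ι 2 * m + 1ℚ) * (h * (½ + j)) * i * ((M + m + 1ℚ) * f) * k
      expanded = solve-∀ ℚ-ring

    D-G-top-identity : ∀ (σ g v h i f k n r : ℚ) → let m = n + 1ℚ ; s = m + n + 1ℚ in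
      G-value σ (g * ((n + 1ℚ) * v) * 1ℚ) n h ((½ + s) * i) f (k * (½ + r))
        + (½ + r) * D-value (σ * - 1ℚ) ((n + 1ℚ) * g * v * 1ℚ) m (h * (½ + n)) i f k
      ≡ 0ℚ
    D-G-top-identity = expanded
      where
      expanded : ∀ (σ g v h i f k n r : ℚ) → let m = n + 1ℚ ; s = m + n + 1ℚ in
        σ * (g * ((n + 1ℚ) * v) * 1ℚ) * (ι 2 * n + 1ℚ) * h * ((½ + s) * i) * f * (k * (½ + r))
          + (½ + r) * (σ * - 1ℚ * ((n + 1ℚ) * g * v * 1ℚ) * (ι 4 * m + 1ℚ) * (h * (½ + n)) * i * f * k)
        ≡ 0ℚ
      expanded = solve-∀ ℚ-ring

  -- The coefficient M - n - 1/2 is the ratio (1/2)_{M-n} / (1/2)_{M-n-1}, by which the expected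
  -- values of the sums for n and n+1 differ up to sign.
  D-G-base : ∀ M n → (ι M - ι n - ½) * D M (suc n) 0 + D M n 0 ≡ G M n 0
  D-G-base M n = begin
    y * D M (suc n) 0 + D M n 0
      ≡⟨ cong₂ (λ a b → y * a + b)
          (D-cong refl (cong (λ x → x * 1ℚ * F⁻¹ (suc n)) (F-suc n)) refl refl refl refl refl)
          (D-cong refl b-eq refl refl (H⁻¹-pred′ (suc n) (ι-suc n)) refl refl) ⟩
    _ ≡⟨ D-G-base-identity (ι M) (ι n) (F n) (F⁻¹ (suc n)) (H⁻¹ (2 ℕ.+ n)) (F (M ℕ.+ 0)) (H M) ⟩
    _ ≡⟨ G-cong refl b-eq refl refl refl (F-suc′ (M ℕ.+ 0) (cong ι (ℕₚ.+-identityʳ M))) refl ⟨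
    G M n 0 ∎
    where
    y = ι M - ι n - ½
    b-eq : F n * 1ℚ * F⁻¹ n ≡ F n * 1ℚ * ((ι n + 1ℚ) * F⁻¹ (suc n))
    b-eq = cong (F n * 1ℚ *_) (F⁻¹-pred n)

  D-G-step : ∀ j e r → let n = suc j ℕ.+ e ; M = suc j ℕ.+ r in
    G M n j + ((ι M - ι n - ½) * D M (suc n) (suc j) + D M n (suc j)) ≡ G M n (suc j)
  D-G-step j e r = begin
    G M n j + ((ι M - ι n - ½) * D M (suc n) m + D M n m)
      ≡⟨ cong₂ _+_
          (G-cong refl
            (cong₂ (λ a b → F n * a * b) (F⁻¹-pred j) (cong F⁻¹ n∸j)) refl refl
            (H⁻¹-pred′ (suc (m ℕ.+ n)) ιs) (cong F (sym (ℕₚ.+-suc M j))) (cong H M∸j))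
          (cong₂ _+_
            (cong₂ (λ a b → (a - b - ½) * D M (suc n) m) ιM ιn)
            refl) ⟩
    G-value (sgn j) (F n * ((ι j + 1ℚ) * F⁻¹ m) * F⁻¹ (suc e)) (ι j) (H j) ((½ + (x + y + 1ℚ)) * H⁻¹ (2 ℕ.+ (m ℕ.+ n))) (F (M ℕ.+ m)) (H r * (½ + ι r))
      + ((z - y - ½) * D M (suc n) m + D M n m)
      ≡⟨ cong (G-value (sgn j) (F n * ((ι j + 1ℚ) * F⁻¹ m) * F⁻¹ (suc e)) (ι j) (H j) ((½ + (x + y + 1ℚ)) * H⁻¹ (2 ℕ.+ (m ℕ.+ n))) (F (M ℕ.+ m)) (H r * (½ + ι r)) +_)
          (cong₂ (λ a b → (z - y - ½) * a + b)
            (D-cong refl (cong₂ (λ a b → a * F⁻¹ m * F⁻¹ b) (F-suc′ n ιn) n∸j)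
              (ι-suc j) refl (cong (λ k → H⁻¹ (suc k)) (ℕₚ.+-suc m n)) refl (cong H M∸m))
            (D-cong refl b-eq (ι-suc j) refl (H⁻¹-pred′ (suc (m ℕ.+ n)) ιs) refl (cong H M∸m))) ⟩
    _ ≡⟨ D-G-step-identity (sgn j) (F n) (F⁻¹ m) (F⁻¹ (suc e)) (H j) (H⁻¹ (2 ℕ.+ (m ℕ.+ n))) (F (M ℕ.+ m)) (H r) (ι j) (ι e) (ι r) ⟩
    _ ≡⟨ G-cong refl b-eq (ι-suc j) refl refl (F-suc′ (M ℕ.+ m) (trans (ι-+ M m) (cong₂ _+_ ιM (ι-suc j)))) (cong H M∸m) ⟨
    G M n m ∎
    where
    m = suc j
    n = m ℕ.+ e
    M = m ℕ.+ r
    x = ι j + 1ℚ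
    y = x + ι e
    z = x + ι r
    ιn : ι n ≡ y
    ιn = trans (ι-+ m e) (cong (_+ ι e) (ι-suc j))
    ιM : ι M ≡ z
    ιM = trans (ι-+ m r) (cong (_+ ι r) (ι-suc j))
    ιs : ι (suc (m ℕ.+ n)) ≡ x + y + 1ℚ
    ιs = ι-suc′ (m ℕ.+ n) (trans (ι-+ m n) (cong₂ _+_ (ι-suc j) ιn))
    n∸m : n ∸ m ≡ e
    n∸m = ℕₚ.m+n∸m≡n m e
    M∸m : M ∸ m ≡ r
    M∸m = ℕₚ.m+n∸m≡n m r
    n∸j : n ∸ j ≡ suc e
    n∸j = trans (cong (_∸ j) (sym (ℕₚ.+-suc j e))) (ℕₚ.m+n∸m≡n j (suc e))
    M∸j : M ∸ j ≡ suc r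
    M∸j = trans (cong (_∸ j) (sym (ℕₚ.+-suc j r))) (ℕₚ.m+n∸m≡n j (suc r))
    b-eq : F n * F⁻¹ m * F⁻¹ (n ∸ m) ≡ F n * F⁻¹ m * ((ι e + 1ℚ) * F⁻¹ (suc e))
    b-eq = cong (F n * F⁻¹ m *_) (trans (cong F⁻¹ n∸m) (F⁻¹-pred e))

  -- The index m = n+1 belongs only to the sum for n+1. It is separate from the general step because
  -- truncated subtraction does not make `D M n (suc n)` vanish, as the true binomial coefficient
  -- would.
  D-G-top : ∀ n r → let M = suc n ℕ.+ r in
    G M n n + (½ + ι r) * D M (suc n) (suc n) ≡ 0ℚ
  D-G-top n r = begin
    G M n n + (½ + ι r) * D M (suc n) (suc n)
      ≡⟨ cong₂ (λ a b → a + (½ + ι r) * b)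
        (G-cong refl (cong₂ (λ a b → F n * a * b) (F⁻¹-pred n) (cong F⁻¹ (ℕₚ.n∸n≡0 n))) refl refl
          (H⁻¹-pred′ (suc (suc n ℕ.+ n)) (ι-suc′ (suc n ℕ.+ n) (trans (ι-+ (suc n) n) (cong (_+ ι n) (ι-suc n)))))
          (cong F (sym (ℕₚ.+-suc M n))) (cong H M∸n))
        (D-cong refl (cong₂ (λ a b → a * F⁻¹ (suc n) * b) (F-suc n) (cong F⁻¹ (ℕₚ.n∸n≡0 n)))
          (ι-suc n) refl (cong (λ k → H⁻¹ (suc k)) (ℕₚ.+-suc (suc n) n)) refl (cong H (ℕₚ.m+n∸m≡n (suc n) r))) ⟩
    _ ≡⟨ D-G-top-identity (sgn n) (F n) (F⁻¹ (suc n)) (H n) (H⁻¹ (2 ℕ.+ (suc n ℕ.+ n))) (F (M ℕ.+ suc n)) (H r) (ι n) (ι r) ⟩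
    0ℚ ∎
    where
    M = suc n ℕ.+ r
    M∸n : M ∸ n ≡ suc r
    M∸n = trans (cong (_∸ n) (sym (ℕₚ.+-suc n r))) (ℕₚ.m+n∸m≡n n (suc r))

  ∑D-telescope : ∀ M n j → j ≤ₙ n → j ≤ₙ M →
    ∑< (suc j) (λ m → (ι M - ι n - ½) * D M (suc n) m + D M n m) ≡ G M n j
  ∑D-telescope M n zero    _   _   = trans (+-identityˡ _) (D-G-base M n)
  ∑D-telescope M n (suc j) j<n j<M = trans
    (cong (_+ ((ι M - ι n - ½) * D M (suc n) (suc j) + D M n (suc j))) (∑D-telescope M n j (ℕₚ.<⇒≤ j<n) (ℕₚ.<⇒≤ j<M)))
    (subst₂ (λ n M → G M n j + ((ι M - ι n - ½) * D M (suc n) (suc j) + D M n (suc j)) ≡ G M n (suc j))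
      (ℕₚ.m+[n∸m]≡n j<n) (ℕₚ.m+[n∸m]≡n j<M) (D-G-step j (n ∸ suc j) (M ∸ suc j)))

  ∑D-step : ∀ n r → let M = suc n ℕ.+ r in
    (½ + ι r) * ∑< (suc (suc n)) (D M (suc n)) + ∑< (suc n) (D M n) ≡ 0ℚ
  ∑D-step n r = begin
    y * (a + d) + b          ≡⟨ shuffle y a d b ⟩
    y * a + b + y * d        ≡⟨ cong (_+ y * d) (trans (cong (λ x → x * a + b) y-eq) (sym (∑<-linear (suc n) y′ (D M (suc n)) (D M n)))) ⟩
    ∑< (suc n) (λ m → y′ * D M (suc n) m + D M n m) + y * d
                             ≡⟨ cong (_+ y * d) (∑D-telescope M n n ℕₚ.≤-refl (ℕₚ.m≤n⇒m≤1+n (ℕₚ.m≤m+n n r))) ⟩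
    G M n n + y * d          ≡⟨ D-G-top n r ⟩
    0ℚ                       ∎
    where
    M = suc n ℕ.+ r
    y = ½ + ι r
    y′ = ι M - ι n - ½
    a = ∑< (suc n) (D M (suc n))
    d = D M (suc n) (suc n)
    b = ∑< (suc n) (D M n)
    shuffle : ∀ y a d b → y * (a + d) + b ≡ y * a + b + y * d
    shuffle = solve-∀ ℚ-ring
    y-eq : y ≡ y′
    y-eq = sym (trans (cong (λ x → x - ι n - ½) (trans (ι-+ (suc n) r) (cong (_+ ι r) (ι-suc n)))) (cancel (ι n) (ι r)))
      where
      cancel : ∀ n r → n + 1ℚ + r - n - ½ ≡ ½ + r
      cancel = solve-∀ ℚ-ring

  opaque
    unfolding D-value

    D-zero : ∀ M → D M 0 0 ≡ ι 2 * 1ℚ * F M * H M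
    D-zero M = trans (cong (λ k → 1ℚ * 1ℚ * (ι 4 * 0ℚ + 1ℚ) * 1ℚ * ι 2 * F k * H M) (ℕₚ.+-identityʳ M)) (simplify (F M) (H M))
      where
      simplify : ∀ f h → 1ℚ * 1ℚ * (ι 4 * 0ℚ + 1ℚ) * 1ℚ * ι 2 * f * h ≡ ι 2 * 1ℚ * f * h
      simplify = solve-∀ ℚ-ring

  dougall-step : ∀ n r → let M = suc n ℕ.+ r in
    ∑< (suc n) (D M n) ≡ ι 2 * sgn n * F M * H (M ∸ n) →
    ∑< (suc (suc n)) (D M (suc n)) ≡ ι 2 * sgn (suc n) * F M * H (M ∸ suc n)
  dougall-step n r ih = begin
    S                                       ≡⟨ unique-quotient (½+-inverse r) (trans (*-comm S y) (neg-unique (∑D-step n r))) ⟩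
    - ∑< (suc n) (D M n) * y⁻¹              ≡⟨ cong (λ x → - x * y⁻¹) (trans ih (cong (λ k → ι 2 * sgn n * F M * H k) M∸n)) ⟩
    - (ι 2 * sgn n * F M * (H r * y)) * y⁻¹ ≡⟨ shuffle (sgn n) (F M) (H r) y y⁻¹ ⟩
    ι 2 * sgn (suc n) * F M * H r * (y * y⁻¹) ≡⟨ cong (ι 2 * sgn (suc n) * F M * H r *_) (½+-inverse r) ⟩
    ι 2 * sgn (suc n) * F M * H r * 1ℚ      ≡⟨ *-identityʳ _ ⟩
    ι 2 * sgn (suc n) * F M * H r           ≡⟨ cong (λ k → ι 2 * sgn (suc n) * F M * H k) (ℕₚ.m+n∸m≡n (suc n) r) ⟨
    ι 2 * sgn (suc n) * F M * H (M ∸ suc n) ∎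
    where
    M = suc n ℕ.+ r
    y = ½ + ι r
    y⁻¹ = ι 2 * recip (2 ℕ.* r)
    S = ∑< (suc (suc n)) (D M (suc n))
    M∸n : M ∸ n ≡ suc r
    M∸n = trans (cong (_∸ n) (sym (ℕₚ.+-suc n r))) (ℕₚ.m+n∸m≡n n (suc r))
    neg-unique : ∀ {a b} → a + b ≡ 0ℚ → a ≡ - b
    neg-unique {a} {b} eq = trans (sym (identity a b)) (trans (cong (_- b) eq) (+-identityˡ (- b)))
      where
      identity : ∀ a b → a + b - b ≡ a
      identity = solve-∀ ℚ-ring
    shuffle : ∀ s f h y z → - (ι 2 * s * f * (h * y)) * z ≡ ι 2 * (s * - 1ℚ) * f * h * (y * z)
    shuffle = solve-∀ ℚ-ring

  dougall : ∀ M n → n ≤ₙ M → ∑< (suc n) (D M n) ≡ ι 2 * sgn n * F M * H (M ∸ n)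
  dougall M zero    _   = trans (+-identityˡ _) (D-zero M)
  dougall M (suc n) n<M = subst
    (λ M → ∑< (suc n) (D M n) ≡ ι 2 * sgn n * F M * H (M ∸ n) →
      ∑< (suc (suc n)) (D M (suc n)) ≡ ι 2 * sgn (suc n) * F M * H (M ∸ suc n))
    (ℕₚ.m+[n∸m]≡n n<M) (dougall-step n (M ∸ suc n)) (dougall M n (ℕₚ.<⇒≤ n<M))

  -- Splitting, merging and reversing finite sums and products.

  ∑<-cong : ∀ n {f g : ℕ → ℚ} → (∀ i → f i ≡ g i) → ∑< n f ≡ ∑< n g
  ∑<-cong zero    f≗g = refl
  ∑<-cong (suc n) f≗g = cong₂ _+_ (∑<-cong n f≗g) (f≗g n)

  ∑<-+ : ∀ m n f → ∑< (m ℕ.+ n) f ≡ ∑< m f + ∑< n (λ i → f (m ℕ.+ i))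
  ∑<-+ m zero    f = trans (cong (λ k → ∑< k f) (ℕₚ.+-identityʳ m)) (sym (+-identityʳ (∑< m f)))
  ∑<-+ m (suc n) f = begin
    ∑< (m ℕ.+ suc n) f                                          ≡⟨ cong (λ k → ∑< k f) (ℕₚ.+-suc m n) ⟩
    ∑< (m ℕ.+ n) f + f (m ℕ.+ n)                                ≡⟨ cong (_+ f (m ℕ.+ n)) (∑<-+ m n f) ⟩
    ∑< m f + ∑< n (λ i → f (m ℕ.+ i)) + f (m ℕ.+ n)             ≡⟨ +-assoc (∑< m f) _ _ ⟩
    ∑< m f + (∑< n (λ i → f (m ℕ.+ i)) + f (m ℕ.+ n))           ∎

  ∏<-+ : ∀ m n f → ∏< (m ℕ.+ n) f ≡ ∏< m f * ∏< n (λ i → f (m ℕ.+ i))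
  ∏<-+ m zero    f = trans (cong (λ k → ∏< k f) (ℕₚ.+-identityʳ m)) (sym (*-identityʳ (∏< m f)))
  ∏<-+ m (suc n) f = begin
    ∏< (m ℕ.+ suc n) f                                          ≡⟨ cong (λ k → ∏< k f) (ℕₚ.+-suc m n) ⟩
    ∏< (m ℕ.+ n) f * f (m ℕ.+ n)                                ≡⟨ cong (_* f (m ℕ.+ n)) (∏<-+ m n f) ⟩
    ∏< m f * ∏< n (λ i → f (m ℕ.+ i)) * f (m ℕ.+ n)             ≡⟨ *-assoc (∏< m f) _ _ ⟩
    ∏< m f * (∏< n (λ i → f (m ℕ.+ i)) * f (m ℕ.+ n))           ∎

  ∏<-cong : ∀ n {f g : ℕ → ℚ} → (∀ i → f i ≡ g i) → ∏< n f ≡ ∏< n g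
  ∏<-cong zero    f≗g = refl
  ∏<-cong (suc n) f≗g = cong₂ _*_ (∏<-cong n f≗g) (f≗g n)

  ∏<-* : ∀ n f g → ∏< n f * ∏< n g ≡ ∏< n (λ i → f i * g i)
  ∏<-* zero    f g = refl
  ∏<-* (suc n) f g = trans (shuffle (∏< n f) (f n) (∏< n g) (g n)) (cong (_* (f n * g n)) (∏<-* n f g))
    where
    shuffle : ∀ a b c d → a * b * (c * d) ≡ a * c * (b * d)
    shuffle = solve-∀ ℚ-ring

  -- Removing the lowest factor turns y into y+1 and leaves the upper end unchanged, so the
  -- induction has to vary y.
  ∏<-reverse : ∀ n y → ∏< n (λ i → y + ι i) ≡ ∏< n (λ i → y + ι n - (ι i + 1ℚ))
  ∏<-reverse zero    y = refl
  ∏<-reverse (suc n) y = begin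
    ∏< (suc n) (λ i → y + ι i)                               ≡⟨ ∏<-+ 1 n (λ i → y + ι i) ⟩
    1ℚ * (y + 0ℚ) * ∏< n (λ i → y + ι (suc i))               ≡⟨ cong (1ℚ * (y + 0ℚ) *_) (trans (∏<-cong n λ i → trans (cong (λ x → y + x) (ι-suc i)) (s₁ y (ι i))) (∏<-reverse n (y + 1ℚ))) ⟩
    1ℚ * (y + 0ℚ) * ∏< n (λ i → y + 1ℚ + ι n - (ι i + 1ℚ))   ≡⟨ cong₂ _*_ (s₂ y (ι n)) (∏<-cong n λ i → cong (_- (ι i + 1ℚ)) (s₃ y (ι n))) ⟩
    (y + (ι n + 1ℚ) - (ι n + 1ℚ)) * ∏< n (λ i → y + (ι n + 1ℚ) - (ι i + 1ℚ)) ≡⟨ *-comm (y + (ι n + 1ℚ) - (ι n + 1ℚ)) (∏< n (λ i → y + (ι n + 1ℚ) - (ι i + 1ℚ))) ⟩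
    ∏< (suc n) (λ i → y + (ι n + 1ℚ) - (ι i + 1ℚ))           ≡⟨ cong (λ x → ∏< (suc n) (λ i → y + x - (ι i + 1ℚ))) (ι-suc n) ⟨
    ∏< (suc n) (λ i → y + ι (suc n) - (ι i + 1ℚ))            ∎
    where
    s₁ : ∀ y i → y + (i + 1ℚ) ≡ y + 1ℚ + i
    s₁ = solve-∀ ℚ-ring
    s₂ : ∀ y n → 1ℚ * (y + 0ℚ) ≡ y + (n + 1ℚ) - (n + 1ℚ)
    s₂ = solve-∀ ℚ-ring
    s₃ : ∀ y n → y + 1ℚ + n ≡ y + (n + 1ℚ)
    s₃ = solve-∀ ℚ-ring

  -- p-integral rationals

  module PIntegral (p : ℕ) (p-prime : Prime p) where

    -- Any denominator prime to p is allowed, not only the reduced one. Closure under sums and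
    -- products then follows from Euclid's lemma without reducing fractions.
    record Int (x : ℚ) : Set where
      constructor mkInt
      field
        denominator : ℕ
        numerator   : ℤ
        p∤denom     : p ∤ denominator
        equation    : x * ι denominator ≡ ιℤ numerator

    p∤1 : p ∤ 1
    p∤1 p∣1 = contradiction (∣1⇒≡1 p∣1) (ℕ.nonTrivial⇒≢1 {{prime⇒nonTrivial p-prime}})

    p∤* : ∀ {d e} → p ∤ d → p ∤ e → p ∤ d ℕ.* e
    p∤* {d} {e} p∤d p∤e p∣de with euclidsLemma d e p-prime p∣de
    ... | inj₁ p∣d = p∤d p∣d
    ... | inj₂ p∣e = p∤e p∣e

    Int-ιℤ : ∀ a → Int (ιℤ a)
    Int-ιℤ a = mkInt 1 a p∤1 (*-identityʳ (ιℤ a))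

    Int-ι : ∀ n → Int (ι n)
    Int-ι n = Int-ιℤ (posℤ n)

    Int-+ : ∀ {x y} → Int x → Int y → Int (x + y)
    Int-+ {x} {y} (mkInt d a p∤d xd) (mkInt e b p∤e ye) =
      mkInt (d ℕ.* e) (a ℤ.* posℤ e ℤ.+ b ℤ.* posℤ d) (p∤* p∤d p∤e) (begin
        (x + y) * ι (d ℕ.* e)              ≡⟨ cong ((x + y) *_) (ι-* d e) ⟩
        (x + y) * (ι d * ι e)              ≡⟨ shuffle x y (ι d) (ι e) ⟩
        x * ι d * ι e + y * ι e * ι d      ≡⟨ cong₂ (λ u v → u * ι e + v * ι d) xd ye ⟩
        ιℤ a * ι e + ιℤ b * ι d            ≡⟨ cong₂ _+_ (ιℤ-* a (posℤ e)) (ιℤ-* b (posℤ d)) ⟨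
        ιℤ (a ℤ.* posℤ e) + ιℤ (b ℤ.* posℤ d)    ≡⟨ ιℤ-+ (a ℤ.* posℤ e) (b ℤ.* posℤ d) ⟨
        ιℤ (a ℤ.* posℤ e ℤ.+ b ℤ.* posℤ d)       ∎)
      where
      shuffle : ∀ x y d e → (x + y) * (d * e) ≡ x * d * e + y * e * d
      shuffle = solve-∀ ℚ-ring

    Int-* : ∀ {x y} → Int x → Int y → Int (x * y)
    Int-* {x} {y} (mkInt d a p∤d xd) (mkInt e b p∤e ye) =
      mkInt (d ℕ.* e) (a ℤ.* b) (p∤* p∤d p∤e) (begin
        x * y * ι (d ℕ.* e)     ≡⟨ cong (x * y *_) (ι-* d e) ⟩
        x * y * (ι d * ι e)     ≡⟨ shuffle x y (ι d) (ι e) ⟩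
        x * ι d * (y * ι e)     ≡⟨ cong₂ _*_ xd ye ⟩
        ιℤ a * ιℤ b             ≡⟨ ιℤ-* a b ⟨
        ιℤ (a ℤ.* b)            ∎)
      where
      shuffle : ∀ x y d e → x * y * (d * e) ≡ x * d * (y * e)
      shuffle = solve-∀ ℚ-ring

    Int-neg : ∀ {x} → Int x → Int (- x)
    Int-neg {x} int = subst Int (identity x) (Int-* (Int-ιℤ ℤ.-1ℤ) int)
      where
      identity : ∀ x → - 1ℚ * x ≡ - x
      identity = solve-∀ ℚ-ring

    Int-recip : ∀ {k} → p ∤ suc k → Int (recip k)
    Int-recip {k} p∤ = mkInt (suc k) (posℤ 1) p∤ (/-ι (posℤ 1) (suc k))

    Int-∏ : ∀ n {f} → (∀ i → i <ₙ n → Int (f i)) → Int (∏< n f)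
    Int-∏ zero    int = Int-ι 1
    Int-∏ (suc n) int = Int-* (Int-∏ n λ i i<n → int i (ℕₚ.m<n⇒m<1+n i<n)) (int n ℕₚ.≤-refl)

    -- Cross-multiplying the reduced fraction n/d with a/e gives n e = a d. As n is coprime to d, d
    -- divides e, so p cannot divide d.
    Int⇒Integral : ∀ {x} → Int x → Integralₚ p x
    Int⇒Integral {x@(mkℚ n d-1 n⊥d)} (mkInt e a p∤e xe) {i} (i∣d , i∣p) with prime⇒irreducible p-prime i∣p
    ... | inj₁ i≡1 = i≡1
    ... | inj₂ refl = contradiction (∣-trans i∣d d∣e) p∤e
      where
      cross : n ℤ.* posℤ e ≡ a ℤ.* posℤ (suc d-1)
      cross with ℚᵘ.*≡* eq ← ℚᵘₚ.≃-trans (ℚᵘₚ.≃-sym (ℚᵘₚ.≃-trans (toℚᵘ-homo-* x (ι e)) (ℚᵘₚ.*-congˡ {toℚᵘ x} (toℚᵘ-fromℚᵘ (ℚᵘ.mkℚᵘ (posℤ e) 0)))))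
                           (ℚᵘₚ.≃-trans (ℚᵘₚ.≃-reflexive (cong toℚᵘ xe)) (toℚᵘ-fromℚᵘ (ℚᵘ.mkℚᵘ a 0)))
        = trans (sym (ℤₚ.*-identityʳ (n ℤ.* posℤ e))) (trans eq (cong (λ k → a ℤ.* posℤ k) (ℕₚ.*-identityʳ (suc d-1))))
      d∣e : suc d-1 ∣ e
      d∣e = coprime-divisor {m = suc d-1} {n = ℤ.∣ n ∣} (Coprimality.sym (Coprimality.recompute n⊥d))
        (divides ℤ.∣ a ∣ (trans (sym (ℤₚ.abs-* n (posℤ e))) (trans (cong ℤ.∣_∣ cross) (ℤₚ.abs-* a (posℤ (suc d-1))))))

    record P^ (k : ℕ) (x : ℚ) : Set where
      constructor mkP^
      field
        quotient     : ℚ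
        Int-quotient : Int quotient
        equation     : x ≡ ι (p ℕ.^ k) * quotient

    P^-0 : ∀ {x} → Int x → P^ 0 x
    P^-0 {x} int = mkP^ x int (sym (*-identityˡ x))

    P^⇒Int : ∀ {k x} → P^ k x → Int x
    P^⇒Int {k} (mkP^ z int eq) = subst Int (sym eq) (Int-* (Int-ι (p ℕ.^ k)) int)

    P^-zero : ∀ k → P^ k 0ℚ
    P^-zero k = mkP^ 0ℚ (Int-ι 0) (sym (*-zeroʳ (ι (p ℕ.^ k))))

    P^-+ : ∀ {k x y} → P^ k x → P^ k y → P^ k (x + y)
    P^-+ {k} (mkP^ z Iz xz) (mkP^ w Iw yw) =
      mkP^ (z + w) (Int-+ Iz Iw) (trans (cong₂ _+_ xz yw) (sym (*-distribˡ-+ (ι (p ℕ.^ k)) z w)))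

    P^-* : ∀ {j k x y} → P^ j x → P^ k y → P^ (j ℕ.+ k) (x * y)
    P^-* {j} {k} {x} {y} (mkP^ z Iz xz) (mkP^ w Iw yw) = mkP^ (z * w) (Int-* Iz Iw) (begin
      x * y                                       ≡⟨ cong₂ _*_ xz yw ⟩
      ι (p ℕ.^ j) * z * (ι (p ℕ.^ k) * w)         ≡⟨ shuffle (ι (p ℕ.^ j)) z (ι (p ℕ.^ k)) w ⟩
      ι (p ℕ.^ j) * ι (p ℕ.^ k) * (z * w)         ≡⟨ cong (_* (z * w)) (trans (cong ι (ℕₚ.^-distribˡ-+-* p j k)) (ι-* (p ℕ.^ j) (p ℕ.^ k))) ⟨
      ι (p ℕ.^ (j ℕ.+ k)) * (z * w)               ∎)
      where
      shuffle : ∀ a b c d → a * b * (c * d) ≡ a * c * (b * d)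
      shuffle = solve-∀ ℚ-ring

    P^-*ˡ : ∀ {k x y} → Int x → P^ k y → P^ k (x * y)
    P^-*ˡ int py = P^-* (P^-0 int) py

    P^-*ʳ : ∀ {k x y} → P^ k x → Int y → P^ k (x * y)
    P^-*ʳ {k} {x} {y} px int = subst (P^ k) (*-comm y x) (P^-*ˡ int px)

    P^-p : P^ 1 (ι p)
    P^-p = mkP^ 1ℚ (Int-ι 1) (sym (trans (*-identityʳ _) (cong ι (ℕₚ.^-identityʳ p))))

    P^-∑ : ∀ {k} n {f} → (∀ i → i <ₙ n → P^ k (f i)) → P^ k (∑< n f)
    P^-∑ {k} zero    pf = P^-zero k
    P^-∑ {k} (suc n) pf = P^-+ (P^-∑ n λ i i<n → pf i (ℕₚ.m<n⇒m<1+n i<n)) (pf n ℕₚ.≤-refl)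

    -- The factors are exchanged one at a time, by ab - cd = (a-c)b + c(b-d).
    ∏-congruent : ∀ {k} n {f g} → (∀ i → i <ₙ n → Int (f i)) → (∀ i → i <ₙ n → Int (g i)) →
      (∀ i → i <ₙ n → P^ k (f i - g i)) → P^ k (∏< n f - ∏< n g)
    ∏-congruent {k} zero    If Ig f≡g = P^-zero k
    ∏-congruent {k} (suc n) {f} {g} If Ig f≡g = subst (P^ k) (identity (∏< n f) (f n) (∏< n g) (g n))
      (P^-+ (P^-*ʳ (∏-congruent n (λ i i<n → If i (ℕₚ.m<n⇒m<1+n i<n)) (λ i i<n → Ig i (ℕₚ.m<n⇒m<1+n i<n)) (λ i i<n → f≡g i (ℕₚ.m<n⇒m<1+n i<n))) (If n ℕₚ.≤-refl))
                (P^-*ˡ (Int-∏ n λ i i<n → Ig i (ℕₚ.m<n⇒m<1+n i<n)) (f≡g n ℕₚ.≤-refl)))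
      where
      identity : ∀ a b c d → (a - c) * b + c * (b - d) ≡ a * b - c * d
      identity = solve-∀ ℚ-ring

    P^⇒≡mod : ∀ {x y} k → Int y → P^ k (x - y) → x ≡ y [mod p ^ k ]
    P^⇒≡mod {x} {y} k Iy x≡y@(mkP^ z Iz eq) =
      Int⇒Integral (subst Int (identity x y) (Int-+ (P^⇒Int x≡y) Iy)) , Int⇒Integral Iy , z , Int⇒Integral Iz , eq
      where
      identity : ∀ x y → x - y + y ≡ x
      identity = solve-∀ ℚ-ring

  -- The congruence modulo p³

  odd-prime⇒positive : ∀ n → Prime (suc (n ℕ.+ n)) → 1 ≤ₙ n
  odd-prime⇒positive zero    1-prime = contradiction refl (ℕ.nonTrivial⇒≢1 {{prime⇒nonTrivial 1-prime}})
  odd-prime⇒positive (suc n) _       = s≤s z≤n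

  module Congruence (n : ℕ) (p-prime : Prime (suc (n ℕ.+ n))) where

    p M : ℕ
    p = suc (n ℕ.+ n)
    M = p ℕ.+ (n ℕ.+ n)

    open PIntegral p p-prime

    π : ℚ
    π = ι n + ι n + 1ℚ

    ιp : ι p ≡ π
    ιp = ι-suc′ (n ℕ.+ n) (ι-+ n n)

    P^-π : P^ 1 π
    P^-π = subst (P^ 1) ιp P^-p

    Int-π : Int π
    Int-π = P^⇒Int P^-π

    p∤small : ∀ {k} → suc k <ₙ p → p ∤ suc k
    p∤small = >⇒∤

    p∤p+small : ∀ {k} → suc k <ₙ p → p ∤ p ℕ.+ suc k
    p∤p+small k<p p∣ = p∤small k<p (∣m+n∣m⇒∣n p∣ ∣-refl)

    n≥1 : 1 ≤ₙ n
    n≥1 = odd-prime⇒positive n p-prime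

    Int-½ : Int ½
    Int-½ = Int-recip {1} (>⇒∤ (s≤s (ℕₚ.+-mono-≤ n≥1 n≥1)))

    Int-½+ι : ∀ k → Int (½ + ι k)
    Int-½+ι k = Int-+ Int-½ (Int-ι k)

    -- Powers of p in the factors of `φ`.

    Int-F⁻¹ : ∀ m → m <ₙ p → Int (F⁻¹ m)
    Int-F⁻¹ m m<p = Int-∏ m λ i i<m → Int-recip (p∤small (ℕₚ.≤-<-trans i<m m<p))

    -- Below 2p the only positive multiple of p is p itself, so one factor p clears the whole
    -- denominator.
    Int-π*F⁻¹ : ∀ k → k <ₙ p → Int (π * F⁻¹ (p ℕ.+ k))
    Int-π*F⁻¹ zero    _   = subst Int eq (Int-F⁻¹ (n ℕ.+ n) ℕₚ.≤-refl)
      where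
      eq : F⁻¹ (n ℕ.+ n) ≡ π * F⁻¹ (p ℕ.+ 0)
      eq = trans (F⁻¹-pred′ (n ℕ.+ n) (ι-+ n n)) (cong (λ k → π * F⁻¹ k) (sym (ℕₚ.+-identityʳ p)))
    Int-π*F⁻¹ (suc k) k<p = subst Int eq
      (Int-* (Int-π*F⁻¹ k (ℕₚ.<⇒≤ k<p)) (Int-recip (subst (p ∤_) (ℕₚ.+-suc p k) (p∤p+small k<p))))
      where
      eq : π * F⁻¹ (p ℕ.+ k) * recip (p ℕ.+ k) ≡ π * F⁻¹ (p ℕ.+ suc k)
      eq = trans (*-assoc π (F⁻¹ (p ℕ.+ k)) (recip (p ℕ.+ k))) (cong (λ j → π * F⁻¹ j) (sym (ℕₚ.+-suc p k)))

    P^-F⁻¹M : ∀ {k x} → P^ (suc k) x → P^ k (x * F⁻¹ M)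
    P^-F⁻¹M {k} {x} (mkP^ z Iz eq) = mkP^ (z * (π * F⁻¹ M)) (Int-* Iz (Int-π*F⁻¹ (n ℕ.+ n) ℕₚ.≤-refl)) (begin
      x * F⁻¹ M                                   ≡⟨ cong (_* F⁻¹ M) eq ⟩
      ι (p ℕ.* p ℕ.^ k) * z * F⁻¹ M               ≡⟨ cong (λ y → y * z * F⁻¹ M) (trans (ι-* p (p ℕ.^ k)) (cong (_* ι (p ℕ.^ k)) ιp)) ⟩
      π * ι (p ℕ.^ k) * z * F⁻¹ M                 ≡⟨ shuffle π (ι (p ℕ.^ k)) z (F⁻¹ M) ⟩
      ι (p ℕ.^ k) * (z * (π * F⁻¹ M))             ∎)
      where
      shuffle : ∀ a b c d → a * b * c * d ≡ b * (c * (a * d))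
      shuffle = solve-∀ ℚ-ring

    -- The quotient is (M+1)(M+2)..., and its first factor is M+1 = 2p.
    P^-F-ratio : ∀ m → P^ 1 (F (M ℕ.+ suc m) * F⁻¹ M)
    P^-F-ratio m = subst (P^ 1) (cong (λ k → F k * F⁻¹ M) (sym (ℕₚ.+-suc M m))) (go m)
      where
      go : ∀ m → P^ 1 (F (suc (M ℕ.+ m)) * F⁻¹ M)
      go zero = subst (P^ 1) (sym eq) (P^-*ˡ (Int-ι 2) P^-π)
        where
        double : ∀ x → x + 1ℚ + x + 1ℚ ≡ ι 2 * (x + 1ℚ)
        double = solve-∀ ℚ-ring
        eq : F (suc (M ℕ.+ 0)) * F⁻¹ M ≡ ι 2 * π
        eq = begin
          F (suc (M ℕ.+ 0)) * F⁻¹ M       ≡⟨ cong (λ k → F (suc k) * F⁻¹ M) (ℕₚ.+-identityʳ M) ⟩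
          F (suc M) * F⁻¹ M               ≡⟨ cong (_* F⁻¹ M) (F-suc′ M (trans (ι-+ p (n ℕ.+ n)) (cong₂ _+_ ιp (ι-+ n n)))) ⟩
          (π + (ι n + ι n) + 1ℚ) * F M * F⁻¹ M ≡⟨ *-assoc (π + (ι n + ι n) + 1ℚ) (F M) (F⁻¹ M) ⟩
          (π + (ι n + ι n) + 1ℚ) * (F M * F⁻¹ M) ≡⟨ cong₂ _*_ (double (ι n + ι n)) (F-F⁻¹ M) ⟩
          ι 2 * π * 1ℚ                    ≡⟨ *-identityʳ (ι 2 * π) ⟩
          ι 2 * π                         ∎
      go (suc m) = subst (P^ 1)
        (sym (trans (cong (_* F⁻¹ M) (ι-* (suc (M ℕ.+ suc m)) ((M ℕ.+ suc m) !)))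
          (trans (*-assoc (ι (suc (M ℕ.+ suc m))) (F (M ℕ.+ suc m)) (F⁻¹ M)) (cong (λ k → ι (suc (M ℕ.+ suc m)) * (F k * F⁻¹ M)) (ℕₚ.+-suc M m)))))
        (P^-*ˡ (Int-ι (suc (M ℕ.+ suc m))) (go m))

    Int-H : ∀ k → Int (H k)
    Int-H k = Int-∏ k λ i _ → Int-½+ι i

    ½+n≡½π : ½ + ι n ≡ ½ * π
    ½+n≡½π = identity (ι n)
      where
      identity : ∀ n → ½ + n ≡ ½ * (n + n + 1ℚ)
      identity = solve-∀ ℚ-ring

    P^-H-+ : ∀ {k} m → P^ k (H m) → ∀ i → P^ k (H (m ℕ.+ i))
    P^-H-+ {k} m pm i = subst (P^ k) (sym (∏<-+ m i (λ i → ½ + ι i)))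
      (P^-*ʳ pm (Int-∏ i λ j _ → Int-½+ι (m ℕ.+ j)))

    P^1-H : ∀ {m} → n <ₙ m → P^ 1 (H m)
    P^1-H {m} n<m = subst (λ k → P^ 1 (H k)) (ℕₚ.m+[n∸m]≡n n<m)
      (P^-H-+ (suc n) (P^-*ˡ (Int-H n) (subst (P^ 1) (sym ½+n≡½π) (P^-*ˡ Int-½ P^-π))) (m ∸ suc n))

    -- The factor of index n is p/2; the next multiple of p is the factor of index 3n+1, namely
    -- 3p/2.
    P^2-H : ∀ {m} → suc n ℕ.+ (n ℕ.+ n) <ₙ m → P^ 2 (H m)
    P^2-H {m} 3n+1<m = subst (λ k → P^ 2 (H k)) (ℕₚ.m+[n∸m]≡n 3n+1<m)
      (P^-H-+ (suc 3n+1) (P^-* (P^1-H (ℕₚ.m≤m+n (suc n) (n ℕ.+ n))) (subst (P^ 1) (sym eq) (P^-*ˡ (Int-* (Int-ι 3) Int-½) P^-π))) (m ∸ suc 3n+1))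
      where
      3n+1 = suc n ℕ.+ (n ℕ.+ n)
      identity : ∀ n → ½ + (n + 1ℚ + (n + n)) ≡ ι 3 * ½ * (n + n + 1ℚ)
      identity = solve-∀ ℚ-ring
      eq : ½ + ι 3n+1 ≡ ι 3 * ½ * π
      eq = trans (cong (½ +_) (trans (ι-+ (suc n) (n ℕ.+ n)) (cong₂ _+_ (ι-suc n) (ι-+ n n)))) (identity (ι n))

    opaque
      unfolding φ-value

      φ-split : ∀ m c f k i → φ-value m c f k i ≡ ι 6 * (ι 4 * m + 1ℚ) * (c * c * (f * i * (k * i)))
      φ-split = expanded
        where
        expanded : ∀ m c f k i → ι 6 * (ι 4 * m + 1ℚ) * c * c * (f * k * i * i) ≡ ι 6 * (ι 4 * m + 1ℚ) * (c * c * (f * i * (k * i)))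
        expanded = solve-∀ ℚ-ring

    Int-coefficient : ∀ m → Int (ι 6 * (ι 4 * ι m + 1ℚ))
    Int-coefficient m = Int-* (Int-ι 6) (Int-+ (Int-* (Int-ι 4) (Int-ι m)) (Int-ι 1))

    -- Each of the two factors (1/2)_m / m! contains p/2, the quotient (M+m)!/M! contains 2p, and
    -- the p in (1/2)_{M-m} pays for the remaining 1/M!.
    P^-φ-large : ∀ m → n <ₙ m → m <ₙ p → P^ 3 (φ M m)
    P^-φ-large (suc m) n<m m<p = subst (P^ 3)
      (sym (φ-split (ι (suc m)) (H (suc m) * F⁻¹ (suc m)) (F (M ℕ.+ suc m)) (H (M ∸ suc m)) (F⁻¹ M)))
      (P^-*ˡ (Int-coefficient (suc m)) (P^-* (P^-* P^-c P^-c) (P^-* (P^-F-ratio m) (P^-F⁻¹M (P^1-H n<M∸m)))))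
      where
      P^-c : P^ 1 (H (suc m) * F⁻¹ (suc m))
      P^-c = P^-*ʳ (P^1-H n<m) (Int-F⁻¹ (suc m) m<p)
      n<M∸m : n <ₙ M ∸ suc m
      n<M∸m = ℕₚ.≤-trans (s≤s (ℕₚ.m≤m+n n n)) (ℕₚ.≤-trans (ℕₚ.≤-reflexive (sym (ℕₚ.m+n∸n≡m p (n ℕ.+ n)))) (ℕₚ.∸-monoʳ-≤ M (ℕₚ.≤-pred m<p)))

    -- ξ and ζ are the factors of (1/2)_m / m! and of (-n)_m / (n+3/2)_m; for m = n the
    -- numerators of ξ′ and ζ′ run through the same products in the opposite order.
    b ξ ζ ξ′ ζ′ : ℕ → ℚ
    b i = ι 2 * recip (2 ℕ.* suc (i ℕ.+ n))
    ξ i = (½ + ι i) * recip i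
    ζ i = (ι i - ι n) * b i
    ξ′ i = (½ * π - (ι i + 1ℚ)) * recip i
    ζ′ i = - (ι i + 1ℚ) * b i

    recip-inverse′ : ∀ i → (ι i + 1ℚ) * recip i ≡ 1ℚ
    recip-inverse′ i = trans (cong (_* recip i) (sym (ι-suc i))) (recip-inverse i)

    b-inverse : ∀ i → (½ + (ι i + ι n + 1ℚ)) * b i ≡ 1ℚ
    b-inverse i = trans (cong (λ x → (½ + x) * b i) (sym (ι-suc′ (i ℕ.+ n) (ι-+ i n)))) (½+-inverse (suc (i ℕ.+ n)))

    i<n⇒i<p : ∀ {i} → i <ₙ n → suc i <ₙ p
    i<n⇒i<p i<n = s≤s (ℕₚ.≤-trans i<n (ℕₚ.m≤m+n n n))

    Int-recip-small : ∀ i → i <ₙ n → Int (recip i)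
    Int-recip-small i i<n = Int-recip (p∤small (i<n⇒i<p i<n))

    -- The odd denominator is p + (2i+2), where 0 < 2i+2 < p.
    Int-b : ∀ i → i <ₙ n → Int (b i)
    Int-b i i<n = Int-* (Int-ι 2) (Int-recip (subst (p ∤_) (sym (index i n)) (p∤p+small 2i+2<p)))
      where
      index : ∀ i n → suc (2 ℕ.* suc (i ℕ.+ n)) ≡ suc (n ℕ.+ n) ℕ.+ suc (suc (i ℕ.+ i))
      index = ℕ-solve-∀
      2i+2<p : suc (suc (i ℕ.+ i)) <ₙ p
      2i+2<p = s≤s (subst (_≤ₙ n ℕ.+ n) (ℕₚ.+-suc (suc i) i) (ℕₚ.+-mono-≤ i<n i<n))

    Int-j : ∀ i → Int (ι i + 1ℚ)
    Int-j i = Int-+ (Int-ι i) (Int-ι 1)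

    Int-ξ : ∀ i → i <ₙ n → Int (ξ i)
    Int-ξ i i<n = Int-* (Int-½+ι i) (Int-recip-small i i<n)

    Int-ζ : ∀ i → i <ₙ n → Int (ζ i)
    Int-ζ i i<n = Int-* (Int-+ (Int-ι i) (Int-neg (Int-ι n))) (Int-b i i<n)

    Int-ξ′ : ∀ i → i <ₙ n → Int (ξ′ i)
    Int-ξ′ i i<n = Int-* (Int-+ (Int-* Int-½ Int-π) (Int-neg (Int-j i))) (Int-recip-small i i<n)

    Int-ζ′ : ∀ i → i <ₙ n → Int (ζ′ i)
    Int-ζ′ i i<n = Int-* (Int-neg (Int-j i)) (Int-b i i<n)

    common-denominator : ∀ x a y b {u v} → u * a ≡ 1ℚ → v * b ≡ 1ℚ → x * a - y * b ≡ x * a * (v * b) - y * b * (u * a)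
    common-denominator x a y b ua vb = sym (trans (cong₂ (λ s t → x * a * s - y * b * t) vb ua)
      (cong₂ _-_ (*-identityʳ (x * a)) (*-identityʳ (y * b))))

    -- Over the common denominator the numerator (i+1/2)(i+n+3/2) - (i-n)(i+1) equals p (i+3/4).
    ξ≡ζ : ∀ i → i <ₙ n → P^ 1 (ξ i - ζ i)
    ξ≡ζ i i<n = subst (P^ 1)
      (sym (trans (common-denominator (½ + ι i) (recip i) (ι i - ι n) (b i) {ι i + 1ℚ} {½ + (ι i + ι n + 1ℚ)} (recip-inverse′ i) (b-inverse i)) (identity (ι i) (ι n) (recip i) (b i))))
      (P^-*ʳ P^-π (Int-* (Int-* (Int-+ (Int-ι i) (Int-* (Int-ι 3) (Int-* Int-½ Int-½))) (Int-recip-small i i<n)) (Int-b i i<n)))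
      where
      identity : ∀ i n a b → (½ + i) * a * ((½ + (i + n + 1ℚ)) * b) - (i - n) * b * ((i + 1ℚ) * a)
        ≡ (n + n + 1ℚ) * ((i + ι 3 * (½ * ½)) * a * b)
      identity = solve-∀ ℚ-ring

    -- With j = i+1 the numerator is a difference of squares plus j²: (p/2-j)(p/2+j) + j² = p²/4.
    -- The linear term in p cancels.
    ξ′≡ζ′ : ∀ i → i <ₙ n → P^ 2 (ξ′ i - ζ′ i)
    ξ′≡ζ′ i i<n = subst (P^ 2)
      (sym (trans (common-denominator (½ * π - (ι i + 1ℚ)) (recip i) (- (ι i + 1ℚ)) (b i) {ι i + 1ℚ} {½ + (ι i + ι n + 1ℚ)} (recip-inverse′ i) (b-inverse i)) (identity (ι i) (ι n) (recip i) (b i))))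
      (P^-*ʳ (P^-* P^-π P^-π) (Int-* (Int-* (Int-* Int-½ Int-½) (Int-recip-small i i<n)) (Int-b i i<n)))
      where
      identity : ∀ i n a b → let π = n + n + 1ℚ in
        (½ * π - (i + 1ℚ)) * a * ((½ + (i + n + 1ℚ)) * b) - - (i + 1ℚ) * b * ((i + 1ℚ) * a)
        ≡ π * π * (½ * ½ * a * b)
      identity = solve-∀ ℚ-ring

    -- For m ≤ n, `z m` is (-n)_m / (n+3/2)_m, written with the factors that occur in `D`: the
    -- denominator is (1/2)_{n+m+1} / (1/2)_{n+1}.
    c z : ℕ → ℚ
    c m = H m * F⁻¹ m
    z m = H (suc n) * (sgn m * F n * F⁻¹ (n ∸ m) * H⁻¹ (suc (m ℕ.+ n)))

    c≡∏ξ : ∀ m → c m ≡ ∏< m ξ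
    c≡∏ξ m = ∏<-* m (λ i → ½ + ι i) recip

    z≡∏ζ : ∀ m → m ≤ₙ n → z m ≡ ∏< m ζ
    z≡∏ζ zero    _   = begin
      H (suc n) * (1ℚ * F n * F⁻¹ n * H⁻¹ (suc n))    ≡⟨ shuffle (H (suc n)) (F n) (F⁻¹ n) (H⁻¹ (suc n)) ⟩
      F n * F⁻¹ n * (H (suc n) * H⁻¹ (suc n))         ≡⟨ cong₂ _*_ (F-F⁻¹ n) (H-H⁻¹ (suc n)) ⟩
      1ℚ                                              ∎
      where
      shuffle : ∀ a b c d → a * (1ℚ * b * c * d) ≡ b * c * (a * d)
      shuffle = solve-∀ ℚ-ring
    z≡∏ζ (suc m) m<n = begin
      H (suc n) * (sgn m * - 1ℚ * F n * F⁻¹ e * (H⁻¹ (suc (m ℕ.+ n)) * b m))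
        ≡⟨ cong (λ x → H (suc n) * (sgn m * - 1ℚ * F n * x * (H⁻¹ (suc (m ℕ.+ n)) * b m))) (F⁻¹-pred e) ⟩
      H (suc n) * (sgn m * - 1ℚ * F n * ((ι e + 1ℚ) * F⁻¹ (suc e)) * (H⁻¹ (suc (m ℕ.+ n)) * b m))
        ≡⟨ shuffle (H (suc n)) (sgn m) (F n) (ι e) (F⁻¹ (suc e)) (H⁻¹ (suc (m ℕ.+ n))) (b m) (ι m) ⟩
      H (suc n) * (sgn m * F n * F⁻¹ (suc e) * H⁻¹ (suc (m ℕ.+ n))) * ((ι m - (ι m + 1ℚ + ι e)) * b m)
        ≡⟨ cong₂ (λ k x → H (suc n) * (sgn m * F n * F⁻¹ k * H⁻¹ (suc (m ℕ.+ n))) * ((ι m - x) * b m))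
            (sym (ℕₚ.+-∸-assoc 1 m<n))
            (trans (cong (_+ ι e) (sym (ι-suc m))) (trans (sym (ι-+ (suc m) e)) (cong ι (ℕₚ.m+[n∸m]≡n m<n)))) ⟩
      z m * ζ m
        ≡⟨ cong (_* ζ m) (z≡∏ζ m (ℕₚ.<⇒≤ m<n)) ⟩
      ∏< (suc m) ζ ∎
      where
      e = n ∸ suc m
      shuffle : ∀ h s f e v i b m → h * (s * - 1ℚ * f * ((e + 1ℚ) * v) * (i * b))
        ≡ h * (s * f * v * i) * ((m - (m + 1ℚ + e)) * b)
      shuffle = solve-∀ ℚ-ring

    H-reverse : H n ≡ ∏< n (λ i → ½ * π - (ι i + 1ℚ))
    H-reverse = trans (∏<-reverse n ½) (∏<-cong n λ i → cong (_- (ι i + 1ℚ)) ½+n≡½π)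

    c≡∏ξ′ : c n ≡ ∏< n ξ′
    c≡∏ξ′ = trans (cong (_* F⁻¹ n) H-reverse) (∏<-* n (λ i → ½ * π - (ι i + 1ℚ)) recip)

    ∏ζ≡∏ζ′ : ∏< n ζ ≡ ∏< n ζ′
    ∏ζ≡∏ζ′ = begin
      ∏< n ζ                                          ≡⟨ ∏<-* n (λ i → ι i - ι n) b ⟨
      ∏< n (λ i → ι i - ι n) * ∏< n b                 ≡⟨ cong (_* ∏< n b) (trans (∏<-cong n λ i → +-comm (ι i) (- ι n)) (∏<-reverse n (- ι n))) ⟩
      ∏< n (λ i → - ι n + ι n - (ι i + 1ℚ)) * ∏< n b  ≡⟨ cong (_* ∏< n b) (∏<-cong n λ i → cancel (ι n) (ι i)) ⟩
      ∏< n (λ i → - (ι i + 1ℚ)) * ∏< n b              ≡⟨ ∏<-* n (λ i → - (ι i + 1ℚ)) b ⟩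
      ∏< n ζ′                                         ∎
      where
      cancel : ∀ n i → - n + n - (i + 1ℚ) ≡ - (i + 1ℚ)
      cancel = solve-∀ ℚ-ring

    c≡z-mod-p : ∀ m → m ≤ₙ n → P^ 1 (c m - z m)
    c≡z-mod-p m m≤n = subst (P^ 1) (sym (cong₂ _-_ (c≡∏ξ m) (z≡∏ζ m m≤n)))
      (∏-congruent m (λ i i<m → Int-ξ i (ℕₚ.<-≤-trans i<m m≤n)) (λ i i<m → Int-ζ i (ℕₚ.<-≤-trans i<m m≤n)) (λ i i<m → ξ≡ζ i (ℕₚ.<-≤-trans i<m m≤n)))

    c≡z-mod-p² : P^ 2 (c n - z n)
    c≡z-mod-p² = subst (P^ 2) (sym (cong₂ _-_ c≡∏ξ′ (trans (z≡∏ζ n ℕₚ.≤-refl) ∏ζ≡∏ζ′)))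
      (∏-congruent n Int-ξ′ Int-ζ′ ξ′≡ζ′)

    -- Comparison of `φ` with the Dougall terms.

    K : ℚ
    K = ι 6 * H (suc n) * F⁻¹ M * F⁻¹ M

    opaque
      unfolding φ-value D-value

      -- The constant `K` is chosen so that `K * D M n m` is `φ M m` with one factor `c m` replaced
      -- by `z m`; everything else can be taken out of the difference.
      φ-D : ∀ m → φ M m - K * D M n m
        ≡ ι 6 * (ι 4 * ι m + 1ℚ) * (c m * (F (M ℕ.+ m) * F⁻¹ M * (H (M ∸ m) * F⁻¹ M)) * (c m - z m))
      φ-D m = expanded (ι m) (H m) (F⁻¹ m) (F (M ℕ.+ m)) (H (M ∸ m)) (F⁻¹ M) (H (suc n)) (sgn m) (F n) (F⁻¹ (n ∸ m)) (H⁻¹ (suc (m ℕ.+ n)))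
        where
        expanded : ∀ m h v f k i u σ g w j →
          ι 6 * (ι 4 * m + 1ℚ) * (h * v) * (h * v) * (f * k * i * i)
            - ι 6 * u * i * i * (σ * (g * v * w) * (ι 4 * m + 1ℚ) * h * j * f * k)
          ≡ ι 6 * (ι 4 * m + 1ℚ) * (h * v * (f * i * (k * i)) * (h * v - u * (σ * g * w * j)))
        expanded = solve-∀ ℚ-ring

    M≡ : suc n ℕ.+ (n ℕ.+ n) ℕ.+ n ≡ M
    M≡ = index n
      where
      index : ∀ n → suc n ℕ.+ (n ℕ.+ n) ℕ.+ n ≡ suc (n ℕ.+ n) ℕ.+ (n ℕ.+ n)
      index = ℕ-solve-∀

    M∸n : M ∸ n ≡ suc n ℕ.+ (n ℕ.+ n)
    M∸n = trans (cong (_∸ n) (sym M≡)) (ℕₚ.m+n∸n≡m (suc n ℕ.+ (n ℕ.+ n)) n)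

    Int-c : ∀ m → m ≤ₙ n → Int (c m)
    Int-c m m≤n = Int-* (Int-H m) (Int-F⁻¹ m (s≤s (ℕₚ.≤-trans m≤n (ℕₚ.m≤m+n n n))))

    φ≡D-zero : P^ 3 (φ M 0 - K * D M n 0)
    φ≡D-zero = subst (P^ 3) (sym (trans (φ-D 0)
      (trans (cong (λ x → a * (b₀ * (1ℚ - x))) (z≡∏ζ 0 z≤n)) (vanish a b₀))))
      (P^-zero 3)
      where
      a = ι 6 * (ι 4 * ι 0 + 1ℚ)
      b₀ = c 0 * (F (M ℕ.+ 0) * F⁻¹ M * (H M * F⁻¹ M))
      vanish : ∀ a b → a * (b * (1ℚ - 1ℚ)) ≡ 0ℚ
      vanish = solve-∀ ℚ-ring

    -- For 0 < m < n, M-m exceeds 3n+1, so (1/2)_{M-m} / M! keeps one p after the division. The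
    -- other two come from (M+m)!/M! and from c - z.
    φ≡D-below : ∀ m → suc m <ₙ n → P^ 3 (φ M (suc m) - K * D M n (suc m))
    φ≡D-below m m<n = subst (P^ 3) (sym (φ-D (suc m)))
      (P^-*ˡ (Int-coefficient (suc m)) (P^-* (P^-*ˡ (Int-c (suc m) (ℕₚ.<⇒≤ m<n))
        (P^-* (P^-F-ratio m) (P^-F⁻¹M (P^2-H 3n+1<M∸m)))) (c≡z-mod-p (suc m) (ℕₚ.<⇒≤ m<n))))
      where
      3n+1<M∸m : suc n ℕ.+ (n ℕ.+ n) <ₙ M ∸ suc m
      3n+1<M∸m = ℕₚ.m+n≤o⇒m≤o∸n (suc (suc n ℕ.+ (n ℕ.+ n)))
        (ℕₚ.≤-trans (ℕₚ.≤-reflexive (sym (ℕₚ.+-suc (suc n ℕ.+ (n ℕ.+ n)) (suc m))))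
          (ℕₚ.≤-trans (ℕₚ.+-monoʳ-≤ (suc n ℕ.+ (n ℕ.+ n)) m<n) (ℕₚ.≤-reflexive M≡)))

    -- Here M-n = 3n+1, so (1/2)_{M-n} lacks the factor 3p/2; the sharper congruence for c - z
    -- replaces it.
    φ≡D-top : P^ 3 (φ M n - K * D M n n)
    φ≡D-top = subst (P^ 3) (sym (φ-D n))
      (P^-*ˡ (Int-coefficient n) (P^-* (P^-*ˡ (Int-c n ℕₚ.≤-refl)
        (P^-* P^-F (P^-F⁻¹M (P^1-H n<M∸n)))) c≡z-mod-p²))
      where
      P^-F : P^ 1 (F (M ℕ.+ n) * F⁻¹ M)
      P^-F = subst (λ k → P^ 1 (F (M ℕ.+ k) * F⁻¹ M)) (ℕₚ.m+[n∸m]≡n n≥1) (P^-F-ratio (n ∸ 1))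
      n<M∸n : n <ₙ M ∸ n
      n<M∸n = subst (n <ₙ_) (sym M∸n) (ℕₚ.m≤m+n (suc n) (n ℕ.+ n))

    φ≡D : ∀ m → m ≤ₙ n → P^ 3 (φ M m - K * D M n m)
    φ≡D zero    _   = φ≡D-zero
    φ≡D (suc m) m≤n = [ φ≡D-below m , (λ m≡n → subst (λ k → P^ 3 (φ M k - K * D M n k)) (sym m≡n) φ≡D-top) ]′
      (ℕₚ.m≤n⇒m<n∨m≡n m≤n)

    -- Evaluation of the Dougall sum modulo p³.

    Q : ℚ → ℚ
    Q x = ∏< (n ℕ.+ n) (λ i → x + (ι i + 1ℚ))

    -- Reversing the upper half of the product places x + j beside x + p - j.
    Q-paired : ∀ x → Q x ≡ ∏< n (λ i → (x + (ι i + 1ℚ)) * (x + π - (ι i + 1ℚ)))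
    Q-paired x = begin
      Q x ≡⟨ ∏<-+ n n (λ i → x + (ι i + 1ℚ)) ⟩
      ∏< n (λ i → x + (ι i + 1ℚ)) * ∏< n (λ i → x + (ι (n ℕ.+ i) + 1ℚ))
        ≡⟨ cong (∏< n (λ i → x + (ι i + 1ℚ)) *_) (begin
          ∏< n (λ i → x + (ι (n ℕ.+ i) + 1ℚ))              ≡⟨ ∏<-cong n (λ i → trans (cong (λ y → x + (y + 1ℚ)) (ι-+ n i)) (s₁ x (ι n) (ι i))) ⟩
          ∏< n (λ i → x + ι n + 1ℚ + ι i)                  ≡⟨ ∏<-reverse n (x + ι n + 1ℚ) ⟩
          ∏< n (λ i → x + ι n + 1ℚ + ι n - (ι i + 1ℚ))     ≡⟨ ∏<-cong n (λ i → cong (_- (ι i + 1ℚ)) (s₂ x (ι n))) ⟩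
          ∏< n (λ i → x + π - (ι i + 1ℚ))                  ∎) ⟩
      ∏< n (λ i → x + (ι i + 1ℚ)) * ∏< n (λ i → x + π - (ι i + 1ℚ))
        ≡⟨ ∏<-* n (λ i → x + (ι i + 1ℚ)) (λ i → x + π - (ι i + 1ℚ)) ⟩
      ∏< n (λ i → (x + (ι i + 1ℚ)) * (x + π - (ι i + 1ℚ))) ∎
      where
      s₁ : ∀ x n i → x + (n + i + 1ℚ) ≡ x + n + 1ℚ + i
      s₁ = solve-∀ ℚ-ring
      s₂ : ∀ x n → x + n + 1ℚ + n ≡ x + (n + n + 1ℚ)
      s₂ = solve-∀ ℚ-ring

    F-+ : ∀ m k → F (m ℕ.+ k) ≡ F m * ∏< k (λ i → ι m + (ι i + 1ℚ))
    F-+ m zero    = trans (cong F (ℕₚ.+-identityʳ m)) (sym (*-identityʳ (F m)))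
    F-+ m (suc k) = begin
      F (m ℕ.+ suc k)                                  ≡⟨ cong F (ℕₚ.+-suc m k) ⟩
      F (suc (m ℕ.+ k))                                ≡⟨ F-suc′ (m ℕ.+ k) (ι-+ m k) ⟩
      (ι m + ι k + 1ℚ) * F (m ℕ.+ k)                   ≡⟨ cong₂ _*_ (+-assoc (ι m) (ι k) 1ℚ) (F-+ m k) ⟩
      (ι m + (ι k + 1ℚ)) * (F m * q)                   ≡⟨ shuffle (ι m + (ι k + 1ℚ)) (F m) q ⟩
      F m * (q * (ι m + (ι k + 1ℚ)))                   ∎
      where
      q = ∏< k (λ i → ι m + (ι i + 1ℚ))
      shuffle : ∀ a b c → a * (b * c) ≡ b * (c * a)
      shuffle = solve-∀ ℚ-ring

    F-M : F M ≡ π * Q 0ℚ * Q π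
    F-M = begin
      F (p ℕ.+ (n ℕ.+ n))                                     ≡⟨ F-+ p (n ℕ.+ n) ⟩
      F p * ∏< (n ℕ.+ n) (λ i → ι p + (ι i + 1ℚ))             ≡⟨ cong₂ _*_ (F-suc′ (n ℕ.+ n) (ι-+ n n)) (cong Q ιp) ⟩
      π * F (n ℕ.+ n) * Q π                                   ≡⟨ cong (λ x → π * x * Q π) (trans (F-+ 0 (n ℕ.+ n)) (*-identityˡ (Q 0ℚ))) ⟩
      π * Q 0ℚ * Q π                                          ∎

    -- The factor of index n is p/2, and those after it are p/2 + j for 1 ≤ j ≤ p-1.
    H-M∸n : H (M ∸ n) ≡ H n * (½ * π) * Q (½ * π)
    H-M∸n = begin
      H (M ∸ n)                                                     ≡⟨ cong H M∸n ⟩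
      H (suc n ℕ.+ (n ℕ.+ n))                                       ≡⟨ ∏<-+ (suc n) (n ℕ.+ n) (λ i → ½ + ι i) ⟩
      H n * (½ + ι n) * ∏< (n ℕ.+ n) (λ i → ½ + ι (suc n ℕ.+ i))    ≡⟨ cong₂ _*_ (cong (H n *_) ½+n≡½π) (∏<-cong (n ℕ.+ n) λ i →
        trans (cong (λ x → ½ + x) (trans (ι-+ (suc n) i) (cong (_+ ι i) (ι-suc n)))) (identity (ι n) (ι i))) ⟩
      H n * (½ * π) * Q (½ * π)                                     ∎
      where
      identity : ∀ n i → ½ + (n + 1ℚ + i) ≡ ½ * (n + n + 1ℚ) + (i + 1ℚ)
      identity = solve-∀ ℚ-ring

    -- For x = 0, p/2 or p, (x+j)(x+p-j) = j(p-j) + x(x+p) is j(p-j) modulo p². So is -(p/2-j)², the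
    -- contribution of the sign and of the two copies of (1/2)_n. Each side therefore has the factor
    -- (j(p-j))² for every pair.
    paired-products-congruent : P^ 2 (sgn n * H n * H n * Q (½ * π) - Q 0ℚ * Q π)
    paired-products-congruent = subst (P^ 2) (sym (cong₂ _-_ left right)) (∏-congruent n Int-left Int-right congruent)
      where
      l₁ l₂ r₁ r₂ : ℕ → ℚ
      l₁ i = ½ * π - (ι i + 1ℚ)
      l₂ i = (½ * π + (ι i + 1ℚ)) * (½ * π + π - (ι i + 1ℚ))
      r₁ i = (0ℚ + (ι i + 1ℚ)) * (0ℚ + π - (ι i + 1ℚ))
      r₂ i = (π + (ι i + 1ℚ)) * (π + π - (ι i + 1ℚ))
      left : sgn n * H n * H n * Q (½ * π) ≡ ∏< n (λ i → - 1ℚ * l₁ i * l₁ i * l₂ i)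
      left = begin
        sgn n * H n * H n * Q (½ * π)                    ≡⟨ cong₂ (λ h q → sgn n * h * h * q) H-reverse (Q-paired (½ * π)) ⟩
        sgn n * ∏< n l₁ * ∏< n l₁ * ∏< n l₂              ≡⟨ cong (λ x → x * ∏< n l₁ * ∏< n l₂) (∏<-* n (λ _ → - 1ℚ) l₁) ⟩
        ∏< n (λ i → - 1ℚ * l₁ i) * ∏< n l₁ * ∏< n l₂     ≡⟨ cong (_* ∏< n l₂) (∏<-* n (λ i → - 1ℚ * l₁ i) l₁) ⟩
        ∏< n (λ i → - 1ℚ * l₁ i * l₁ i) * ∏< n l₂        ≡⟨ ∏<-* n (λ i → - 1ℚ * l₁ i * l₁ i) l₂ ⟩
        ∏< n (λ i → - 1ℚ * l₁ i * l₁ i * l₂ i)           ∎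
      right : Q 0ℚ * Q π ≡ ∏< n (λ i → r₁ i * r₂ i)
      right = trans (cong₂ _*_ (Q-paired 0ℚ) (Q-paired π)) (∏<-* n r₁ r₂)
      Int-½π : Int (½ * π)
      Int-½π = Int-* Int-½ Int-π
      Int-pair : ∀ {x} → Int x → ∀ i → Int ((x + (ι i + 1ℚ)) * (x + π - (ι i + 1ℚ)))
      Int-pair Ix i = Int-* (Int-+ Ix (Int-j i)) (Int-+ (Int-+ Ix Int-π) (Int-neg (Int-j i)))
      Int-l₁ : ∀ i → Int (l₁ i)
      Int-l₁ i = Int-+ Int-½π (Int-neg (Int-j i))
      Int-left : ∀ i → i <ₙ n → Int (- 1ℚ * l₁ i * l₁ i * l₂ i)
      Int-left i _ = Int-* (Int-* (Int-* (Int-ιℤ ℤ.-1ℤ) (Int-l₁ i)) (Int-l₁ i)) (Int-pair Int-½π i)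
      Int-right : ∀ i → i <ₙ n → Int (r₁ i * r₂ i)
      Int-right i _ = Int-* (Int-pair (Int-ι 0) i) (Int-pair Int-π i)
      identity : ∀ π j → - 1ℚ * (½ * π - j) * (½ * π - j) * ((½ * π + j) * (½ * π + π - j))
          - (0ℚ + j) * (0ℚ + π - j) * ((π + j) * (π + π - j))
        ≡ π * π * (ι 3 * ½ * (j * j - π * j - ½ * ½ * ½ * (π * π)))
      identity = solve-∀ ℚ-ring
      congruent : ∀ i → i <ₙ n → P^ 2 (- 1ℚ * l₁ i * l₁ i * l₂ i - r₁ i * r₂ i)
      congruent i _ = subst (P^ 2) (sym (identity π (ι i + 1ℚ)))
        (P^-*ʳ (P^-* P^-π P^-π) (Int-* (Int-* (Int-ι 3) Int-½)
          (Int-+ (Int-+ (Int-* (Int-j i) (Int-j i)) (Int-neg (Int-* Int-π (Int-j i))))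
            (Int-neg (Int-* (Int-* (Int-* Int-½ Int-½) Int-½) (Int-* Int-π Int-π))))))

    K∑D≡3p : P^ 3 (K * ∑< (suc n) (D M n) - ι 3 * π)
    K∑D≡3p = subst (P^ 3) (sym eq) (P^-* (P^-*ʳ (P^-*ˡ (Int-ι 3) P^-π) (Int-π*F⁻¹ (n ℕ.+ n) ℕₚ.≤-refl)) paired-products-congruent)
      where
      V = sgn n * H n * H n * Q (½ * π) - Q 0ℚ * Q π
      n≤M : n ≤ₙ M
      n≤M = ℕₚ.≤-trans (ℕₚ.m≤n+m n (suc n ℕ.+ (n ℕ.+ n))) (ℕₚ.≤-reflexive M≡)
      s₁ : ∀ u i σ f w → ι 6 * u * i * i * (ι 2 * σ * f * w) ≡ ι 12 * σ * u * w * i * (f * i)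
      s₁ = solve-∀ ℚ-ring
      s₂ : ∀ π h q q₀ q₁ σ i → ι 12 * σ * (h * (½ * π)) * (h * (½ * π) * q) * i * 1ℚ - ι 3 * π * (π * q₀ * q₁ * i)
        ≡ ι 3 * π * (π * i) * (σ * h * h * q - q₀ * q₁)
      s₂ = solve-∀ ℚ-ring
      eq : K * ∑< (suc n) (D M n) - ι 3 * π ≡ ι 3 * π * (π * F⁻¹ M) * V
      eq = begin
        K * ∑< (suc n) (D M n) - ι 3 * π
          ≡⟨ cong (λ x → K * x - ι 3 * π) (dougall M n n≤M) ⟩
        K * (ι 2 * sgn n * F M * H (M ∸ n)) - ι 3 * π
          ≡⟨ cong (_- ι 3 * π) (s₁ (H (suc n)) (F⁻¹ M) (sgn n) (F M) (H (M ∸ n))) ⟩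
        ι 12 * sgn n * H (suc n) * H (M ∸ n) * F⁻¹ M * (F M * F⁻¹ M) - ι 3 * π
          ≡⟨ cong₂ (λ x y → ι 12 * sgn n * (H n * x) * y * F⁻¹ M * (F M * F⁻¹ M) - ι 3 * π) ½+n≡½π H-M∸n ⟩
        ι 12 * sgn n * (H n * (½ * π)) * (H n * (½ * π) * Q (½ * π)) * F⁻¹ M * (F M * F⁻¹ M) - ι 3 * π
          -- Writing 3p as 3p · M!/M!, with M! = p Q(0) Q(p), gives both terms the common factor 3p
          -- · (p/M!). It supplies the third power of p, since p/M! is p-integral.
          ≡⟨ cong₂ (λ x y → ι 12 * sgn n * (H n * (½ * π)) * (H n * (½ * π) * Q (½ * π)) * F⁻¹ M * x - y) (F-F⁻¹ M)
              (sym (trans (cong (ι 3 * π *_) (trans (cong (_* F⁻¹ M) (sym F-M)) (F-F⁻¹ M))) (*-identityʳ (ι 3 * π)))) ⟩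
        ι 12 * sgn n * (H n * (½ * π)) * (H n * (½ * π) * Q (½ * π)) * F⁻¹ M * 1ℚ - ι 3 * π * (π * Q 0ℚ * Q π * F⁻¹ M)
          ≡⟨ s₂ π (H n) (Q (½ * π)) (Q 0ℚ) (Q π) (sgn n) (F⁻¹ M) ⟩
        ι 3 * π * (π * F⁻¹ M) * V ∎

    ∑<-difference : ∀ m f g → ∑< m (λ i → f i - K * g i) ≡ ∑< m f - K * ∑< m g
    ∑<-difference zero    f g = sym (trans (cong (_-_ 0ℚ) (*-zeroʳ K)) (+-inverseʳ 0ℚ))
    ∑<-difference (suc m) f g = trans (cong (_+ (f m - K * g m)) (∑<-difference m f g))
      (shuffle (∑< m f) (∑< m g) (f m) (g m) K)
      where
      shuffle : ∀ a b c d k → a - k * b + (c - k * d) ≡ a + c - k * (b + d)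
      shuffle = solve-∀ ℚ-ring

    ∑t≡3p : P^ 3 (∑< p t - ι (3 ℕ.* p))
    ∑t≡3p = subst (P^ 3) (sym eq)
      (P^-+ (P^-+ (P^-∑ (suc n) λ m m<1+n → φ≡D m (ℕₚ.≤-pred m<1+n))
        (P^-∑ n λ i i<n → P^-φ-large (suc n ℕ.+ i) (s≤s (ℕₚ.m≤m+n n i)) (s≤s (ℕₚ.+-monoʳ-< n i<n)))) K∑D≡3p)
      where
      shuffle : ∀ a b c d → a + b - d ≡ a - c + b + (c - d)
      shuffle = solve-∀ ℚ-ring
      eq : ∑< p t - ι (3 ℕ.* p) ≡ ∑< (suc n) (λ m → φ M m - K * D M n m) + ∑< n (λ i → φ M (suc n ℕ.+ i)) + (K * ∑< (suc n) (D M n) - ι 3 * π)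
      eq = begin
        ∑< p t - ι (3 ℕ.* p)          ≡⟨ cong₂ _-_ (∑t≡∑φ (n ℕ.+ n)) (trans (ι-* 3 p) (cong (ι 3 *_) ιp)) ⟩
        ∑< p (φ M) - ι 3 * π          ≡⟨ cong (_- ι 3 * π) (∑<-+ (suc n) n (φ M)) ⟩
        ∑< (suc n) (φ M) + ∑< n (λ i → φ M (suc n ℕ.+ i)) - ι 3 * π
          ≡⟨ shuffle (∑< (suc n) (φ M)) (∑< n (λ i → φ M (suc n ℕ.+ i))) (K * ∑< (suc n) (D M n)) (ι 3 * π) ⟩
        ∑< (suc n) (φ M) - K * ∑< (suc n) (D M n) + ∑< n (λ i → φ M (suc n ℕ.+ i)) + (K * ∑< (suc n) (D M n) - ι 3 * π)
          ≡⟨ cong (λ x → x + ∑< n (λ i → φ M (suc n ℕ.+ i)) + (K * ∑< (suc n) (D M n) - ι 3 * π)) (∑<-difference (suc n) (φ M) (D M n)) ⟨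
        _ ∎

  -- From p = 2n+1 to an arbitrary odd prime.

  halve : ∀ m → ∃[ n ] (m ≡ n ℕ.+ n ⊎ m ≡ suc (n ℕ.+ n))
  halve zero = 0 , inj₁ refl
  halve (suc m) with halve m
  ... | n , inj₁ refl = n , inj₂ refl
  ... | n , inj₂ refl = suc n , inj₁ (cong suc (sym (ℕₚ.+-suc n n)))

  odd-prime : ∀ p → Prime p → 2 <ₙ p → ∃[ n ] p ≡ suc (n ℕ.+ n)
  odd-prime p p-prime 2<p with halve p
  ... | n , inj₂ p≡2n+1 = n , p≡2n+1
  ... | n , inj₁ p≡2n with prime⇒irreducible p-prime (divides n (trans p≡2n (n+n≡n*2 n)))
    where
    n+n≡n*2 : ∀ n → n ℕ.+ n ≡ n ℕ.* 2
    n+n≡n*2 = ℕ-solve-∀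
  ...   | inj₂ 2≡p = contradiction 2≡p (ℕₚ.<⇒≢ 2<p)

  ∑-congruence : ∀ p → Prime p → 2 <ₙ p → (term : ℕ → ℚ) → (∀ n → term n ≡ t n) →
    ∑[ n < p ] term (toℕ n) ≡ ι (3 ℕ.* p) [mod p ^ 3 ]
  ∑-congruence p p-prime 2<p term term≡t = subst (_≡ ι (3 ℕ.* p) [mod p ^ 3 ])
    (sym (trans (∑-toℕ p term) (∑<-cong p term≡t)))
    (P^⇒≡mod {∑< p t} {ι (3 ℕ.* p)} 3 (Int-ι (3 ℕ.* p)) (∑t≡3p p p-prime (odd-prime p p-prime 2<p)))
    where
    open PIntegral using (P^)
    open PIntegral p p-prime using (P^⇒≡mod; Int-ι)
    ∑t≡3p : ∀ p (p-prime : Prime p) → ∃[ n ] p ≡ suc (n ℕ.+ n) → P^ p p-prime 3 (∑< p t - ι (3 ℕ.* p))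
    ∑t≡3p _ p-prime (n , refl) = Congruence.∑t≡3p n p-prime

open import Defs
open import Data.Fin.Base using (toℕ)
open import Data.Nat.Base using (ℕ; _<_; _*_)
open import Data.Nat.Primality using (Prime)
open import Data.Product.Base using (_×_; _,_)
open import Data.Rational.Properties using (+-0-monoid)
open import Algebra.Properties.Monoid.Sum +-0-monoid using (sum-syntax)

theorem1p3 : ∀ (p : ℕ) → Prime p → 2 < p →
    (∑[ n < p ] (pochhammerTerm (toℕ n)) ≡ fromℕ (3 * p) [mod p ^ 3 ])
    × (∑[ n < p ] (binomialTerm (toℕ n)) ≡ fromℕ (3 * p) [mod p ^ 3 ])
theorem1p3 p p-prime 2<p =
    ∑-congruence p p-prime 2<p pochhammerTerm pochhammerTerm≡t
  , ∑-congruence p p-prime 2<p binomialTerm binomialTerm≡t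
  where open Supercongruence using (∑-congruence; pochhammerTerm≡t; binomialTerm≡t)
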